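{- Let $\mathcal C\in\{\mathrm{ID},\mathrm{CD}\}$. The cut rule is admissible in $\mathsf{LBIQ}(\mathcal C)$: for every sequent $\mathcal R,\mathcal T,\Gamma\vdash\Delta$, labels $w,u$ with $w\twoheadrightarrow^*_{\mathcal R}u$ and formula $\varphi$ such that $\mathcal R,\mathcal T,\Gamma\vdash\Delta,w:\varphi$ and $\mathcal R,\mathcal T,\Gamma,u:\varphi\vdash\Delta$ are sequents provable in $\mathsf{LBIQ}(\mathcal C)$, the sequent $\mathcal R,\mathcal T,\Gamma\vdash\Delta$ is provable in $\mathsf{LBIQ}(\mathcal C)$.
   Context: Syntax. Fix countably infinite sets of variables, of function symbols (countably many of each arity $n\ge0$; arity $0$ = constants) and of predicates of each arity. $\mathrm{Ter}(X)$ is the least set of terms containing the variable set $X$ and closed under function application; $\mathrm{Ter}=\mathrm{Ter}(\mathrm{Var})$. $\mathrm{VT}(t)$ = variables of $t$; $\mathrm{VT}(t_1,\dots,t_n)=\bigcup_i\mathrm{VT}(t_i)$. Formulae: $\varphi::=p(t_1,\dots,t_n)\mid\bot\mid\top\mid\varphi\wedge\varphi\mid\varphi\vee\varphi\mid\varphi\mathbin{ -\!\!<}\varphi\mid\varphi\to\varphi\mid\exists x\varphi\mid\forall x\varphi$ ($\mathbin{ -\!\!<}$ is exclusion); $\varphi(t/x)$ capture-avoiding substitution. Sequents. Labels come from a countably infinite set. Labeled formula $w:\varphi$, relational atom $wRu$, domain atom $w:x$. A sequent is $\mathcal R,\mathcal T,\Gamma\vdash\Delta$ ($\mathcal R$ finite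 multiset of relational atoms, $\mathcal T$ of domain atoms, $\Gamma,\Delta$ of labeled formulae) such that (1) if $\mathcal R\neq\emptyset$ every label in $\mathcal T,\Gamma,\Delta$ occurs in $\mathcal R$, and if $\mathcal R=\emptyset$ exactly one label occurs in $\mathcal T,\Gamma,\Delta$; (2) the directed graph of $\mathcal R$ (edge $(w,u)$ for $wRu$) is connected with no directed or undirected cycles. $w\twoheadrightarrow^*_{\mathcal R}u$ iff $w=u$ or there is a chain $wRv_1,\dots,v_nRu$ in $\mathcal R$. $X_w=\{x\mid u:x\in\mathcal T,\ u\twoheadrightarrow^*_{\mathcal R}w\}$; $t$ is available for $w$ iff $t\in\mathrm{Ter}(X_w)$. $w:\mathrm{VT}(\vec t)$ denotes the atoms $w:x$, $x\in\mathrm{VT}(\vec t)$. Fresh = not occurring in the conclusion; side conditions are evaluated in the conclusion. $\mathsf{LBIQ}(\mathrm{ID})$ (unchanged parts omitted; premises$\,/\,$conclusion): (ax) $\mathcal R,\mathcal T,\Gamma,w:p(\vec t)\vdash\Delta,u:p(\vec t)$ if $w\twoheadrightarrow^*_{\mathcal R}u$; $(\bot L)$ $\Gamma,w:\bot\vdash\Delta$; $(\top R)$ $\Gamma\vdash\Delta,w:\top$; $(\wedge L)$ $\Gamma,w:\varphi,w:\psi\vdash\Delta\,/\,\Gamma,w:\varphi\wedge\psi\vdash\Delta$; $(\wedge R)$ $\Gamma\vdash\Delta,w:\varphi$ and $\Gamma\vdash\Delta,w:\psi\,/\,\Gamma\vdash\Delta,w:\varphi\wedge\psi$; $(\vee L)$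 $\Gamma,w:\varphi\vdash\Delta$ and $\Gamma,w:\psi\vdash\Delta\,/\,\Gamma,w:\varphi\vee\psi\vdash\Delta$; $(\vee R)$ $\Gamma\vdash\Delta,w:\varphi,w:\psi\,/\,\Gamma\vdash\Delta,w:\varphi\vee\psi$; $(\to L)$ $\Gamma,w:\varphi\to\psi\vdash\Delta,u:\varphi$ and $\Gamma,w:\varphi\to\psi,u:\psi\vdash\Delta\,/\,\Gamma,w:\varphi\to\psi\vdash\Delta$ if $w\twoheadrightarrow^*_{\mathcal R}u$; $(\to R)$ $\mathcal R,wRu,\mathcal T,\Gamma,u:\varphi\vdash\Delta,u:\psi\,/\,\mathcal R,\mathcal T,\Gamma\vdash\Delta,w:\varphi\to\psi$, $u$ fresh; $(\mathbin{ -\!\!<}L)$ $\mathcal R,uRw,\mathcal T,\Gamma,u:\varphi\vdash\Delta,u:\psi\,/\,\mathcal R,\mathcal T,\Gamma,w:\varphi\mathbin{ -\!\!<}\psi\vdash\Delta$, $u$ fresh; $(\mathbin{ -\!\!<}R)$ $\Gamma\vdash\Delta,u:\varphi\mathbin{ -\!\!<}\psi,w:\varphi$ and $\Gamma,w:\psi\vdash\Delta,u:\varphi\mathbin{ -\!\!<}\psi\,/\,\Gamma\vdash\Delta,u:\varphi\mathbin{ -\!\!<}\psi$ if $w\twoheadrightarrow^*_{\mathcal R}u$; $(\exists L)$ $\mathcal R,\mathcal T,w:y,\Gamma,w:\varphi(y/x)\vdash\Delta\,/\,\mathcal R,\mathcal T,\Gamma,w:\exists x\varphi\vdash\Delta$,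 $y$ fresh; $(\exists R)$ $\Gamma\vdash\Delta,w:\exists x\varphi,w:\varphi(t/x)\,/\,\Gamma\vdash\Delta,w:\exists x\varphi$ if $t$ available for $w$; $(\forall L)$ $\Gamma,w:\forall x\varphi,u:\varphi(t/x)\vdash\Delta\,/\,\Gamma,w:\forall x\varphi\vdash\Delta$ if $w\twoheadrightarrow^*_{\mathcal R}u$ and $t$ available for $u$; $(\forall R)$ $\mathcal R,wRu,\mathcal T,u:y,\Gamma\vdash\Delta,u:\varphi(y/x)\,/\,\mathcal R,\mathcal T,\Gamma\vdash\Delta,w:\forall x\varphi$, $u,y$ fresh; $(ds)$ $\mathcal R,\mathcal T,w:\mathrm{VT}(\vec t),\Gamma,w:p(\vec t)\vdash\Delta\,/\,\mathcal R,\mathcal T,\Gamma,w:p(\vec t)\vdash\Delta$. $\mathsf{LBIQ}(\mathrm{CD})$: remove $(ds)$, allow any $t\in\mathrm{Ter}$ in $(\exists R)$ and $(\forall L)$ (keeping $w\twoheadrightarrow^*_{\mathcal R}u$ in $(\forall L)$). Proofs are finite trees of rule instances with leaves (ax), $(\bot L)$, $(\top R)$. Sequents differing by a bijective renaming of labels are regarded as mutually derivable. -}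

module Defs where

open import Data.Nat using (ℕ; zero; suc; _≡ᵇ_; _⊔_)
open import Data.Bool using (Bool; true; false; if_then_else_; not; _∨_)
open import Data.List using (List; []; _∷_; _++_; map; concatMap; foldr; lookup; length)
open import Data.List.Membership.Propositional using (_∈_; _∉_)
open import Data.List.Relation.Unary.All using (All)
open import Data.List.Relation.Unary.Unique.Propositional using (Unique)
open import Data.List.Relation.Binary.Permutation.Propositional using (_↭_)
open import Data.Fin using (Fin)
open import Data.Product using (_×_; _,_; proj₁; proj₂; ∃; ∃-syntax)
open import Data.Sum using (_⊎_)
open import Data.Unit using (⊤)
open import Relation.Binary.PropositionalEquality using (_≡_; _≢_)
open import Relation.Nullary using (¬_)
open import Function.Bundles using (_↔_; Inverse)

Var : Set
Var = ℕ

-- A function symbol is (index i, arity = number of arguments):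
-- `fun i ts` is the i-th function symbol of arity (length ts) applied to ts.
-- Arity 0 gives the constants.
data Term : Set where
  var : Var → Term
  fun : ℕ → List Term → Term

mutual
  VT : Term → List Var
  VT (var x)    = x ∷ []
  VT (fun f ts) = VTs ts

  VTs : List Term → List Var
  VTs []       = []
  VTs (t ∷ ts) = VT t ++ VTs ts

mutual
  substT : (Var → Term) → Term → Term
  substT σ (var x)    = σ x
  substT σ (fun f ts) = fun f (substTs σ ts)

  substTs : (Var → Term) → List Term → List Term
  substTs σ []       = []
  substTs σ (t ∷ ts) = substT σ t ∷ substTs σ ts

-- Formulae.  `pred p ts` is the p-th predicate of arity (length ts).
data Formula : Set where
  pred : ℕ → List Term → Formula
  bot  : Formula
  top  : Formula
  and  : Formula → Formula → Formula
  or   : Formula → Formula → Formula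
  excl : Formula → Formula → Formula
  imp  : Formula → Formula → Formula
  ex   : Var → Formula → Formula
  fa   : Var → Formula → Formula

memb : ℕ → List ℕ → Bool
memb x []       = false
memb x (y ∷ ys) = (x ≡ᵇ y) ∨ memb x ys

remove : ℕ → List ℕ → List ℕ
remove x []       = []
remove x (y ∷ ys) = if x ≡ᵇ y then remove x ys else y ∷ remove x ys

maxL : List ℕ → ℕ
maxL = foldr _⊔_ 0

FV : Formula → List Var
FV (pred p ts) = VTs ts
FV bot         = []
FV top         = []
FV (and φ ψ)   = FV φ ++ FV ψ
FV (or φ ψ)    = FV φ ++ FV ψ
FV (excl φ ψ)  = FV φ ++ FV ψ
FV (imp φ ψ)   = FV φ ++ FV ψ
FV (ex x φ)    = remove x (FV φ)
FV (fa x φ)    = remove x (FV φ)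

AllVars : Formula → List Var
AllVars (pred p ts) = VTs ts
AllVars bot         = []
AllVars top         = []
AllVars (and φ ψ)   = AllVars φ ++ AllVars ψ
AllVars (or φ ψ)    = AllVars φ ++ AllVars ψ
AllVars (excl φ ψ)  = AllVars φ ++ AllVars ψ
AllVars (imp φ ψ)   = AllVars φ ++ AllVars ψ
AllVars (ex x φ)    = x ∷ AllVars φ
AllVars (fa x φ)    = x ∷ AllVars φ

upd : (Var → Term) → Var → Term → (Var → Term)
upd σ y t v = if v ≡ᵇ y then t else σ v

-- choice of the bound variable at a binder: keep y unless it would
-- capture a variable of the substituted terms, else take a fresh one
pickBound : (Var → Term) → Var → Formula → Var
pickBound σ y φ =
  let avoid = concatMap (λ v → VT (σ v)) (remove y (FV φ))
  in if memb y avoid then suc (maxL avoid) else y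

substF : (Var → Term) → Formula → Formula
substF σ (pred p ts) = pred p (substTs σ ts)
substF σ bot         = bot
substF σ top         = top
substF σ (and φ ψ)   = and (substF σ φ) (substF σ ψ)
substF σ (or φ ψ)    = or (substF σ φ) (substF σ ψ)
substF σ (excl φ ψ)  = excl (substF σ φ) (substF σ ψ)
substF σ (imp φ ψ)   = imp (substF σ φ) (substF σ ψ)
substF σ (ex y φ)    = let z = pickBound σ y φ in ex z (substF (upd σ y (var z)) φ)
substF σ (fa y φ)    = let z = pickBound σ y φ in fa z (substF (upd σ y (var z)) φ)

_[_/_] : Formula → Term → Var → Formula
φ [ t / x ] = substF (upd var x t) φ

Label : Set
Label = ℕ

RelAtom : Set          -- (w , u) stands for wRu
RelAtom = Label × Label

DomAtom : Set
DomAtom = Label × Var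

LFormula : Set
LFormula = Label × Formula

-- multisets are represented by lists, considered up to permutation (_↭_)
record Sequent : Set where
  constructor mkSeq
  field
    rel : List RelAtom
    dom : List DomAtom
    ant : List LFormula
    suc′ : List LFormula

data Reach (R : List RelAtom) : Label → Label → Set where
  here  : ∀ {w} → Reach R w w
  there : ∀ {w v u} → (w , v) ∈ R → Reach R v u → Reach R w u

data Reach⁺ (R : List RelAtom) : Label → Label → Set where
  one  : ∀ {w u} → (w , u) ∈ R → Reach⁺ R w u
  more : ∀ {w v u} → (w , v) ∈ R → Reach⁺ R v u → Reach⁺ R w u

-- undirected walks in the multigraph of R, recording the (positions of
-- the) edges used
data Walk (R : List RelAtom) : Label → Label → List (Fin (length R)) → Set where
  nil : ∀ {v} → Walk R v v []
  fwd : ∀ {a b c is} (i : Fin (length R)) → lookup R i ≡ (a , b) →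
        Walk R b c is → Walk R a c (i ∷ is)
  bwd : ∀ {a b c is} (i : Fin (length R)) → lookup R i ≡ (a , b) →
        Walk R a c is → Walk R b c (i ∷ is)

verts : List RelAtom → List Label
verts = concatMap (λ e → proj₁ e ∷ proj₂ e ∷ [])

Connected : List RelAtom → Set
Connected R = ∀ a b → a ∈ verts R → b ∈ verts R → ∃[ is ] Walk R a b is

NoDirectedCycle : List RelAtom → Set
NoDirectedCycle R = ∀ w → ¬ Reach⁺ R w w

-- an undirected cycle exists iff there is a nonempty closed walk using
-- each edge (occurrence of a relational atom) at most once
NoUndirectedCycle : List RelAtom → Set
NoUndirectedCycle R = ∀ v is → Walk R v v is → is ≢ [] → ¬ Unique is

labelsTΓΔ : Sequent → List Label
labelsTΓΔ (mkSeq R T Γ Δ) = map proj₁ T ++ map proj₁ Γ ++ map proj₁ Δ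

labels : Sequent → List Label
labels S = verts (Sequent.rel S) ++ labelsTΓΔ S

vars : Sequent → List Var
vars (mkSeq R T Γ Δ) = map proj₂ T ++ concatMap (λ l → AllVars (proj₂ l)) (Γ ++ Δ)

IsSequent : Sequent → Set
IsSequent S@(mkSeq R T Γ Δ) =
  ((R ≢ []) → All (λ l → l ∈ verts R) (labelsTΓΔ S)) ×
  ((R ≡ []) → ∃[ w ] (w ∈ labelsTΓΔ S × All (λ l → l ≡ w) (labelsTΓΔ S))) ×
  Connected R × NoDirectedCycle R × NoUndirectedCycle R

Available : List RelAtom → List DomAtom → Label → Term → Set
Available R T w t = All (λ x → ∃[ v ] ((v , x) ∈ T × Reach R v w)) (VT t)

data Calc : Set where
  ID CD : Calc

TermOK : Calc → List RelAtom → List DomAtom → Label → Term → Set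
TermOK ID R T w t = Available R T w t
TermOK CD R T w t = ⊤

renameSeq : (Label → Label) → Sequent → Sequent
renameSeq f (mkSeq R T Γ Δ) =
  mkSeq (map (λ e → f (proj₁ e) , f (proj₂ e)) R)
        (map (λ d → f (proj₁ d) , proj₂ d) T)
        (map (λ l → f (proj₁ l) , proj₂ l) Γ)
        (map (λ l → f (proj₁ l) , proj₂ l) Δ)

data Prov (C : Calc) : Sequent → Set where
  -- multisets: exchange
  exch : ∀ {R T Γ Δ R′ T′ Γ′ Δ′} → Prov C (mkSeq R T Γ Δ) →
         R ↭ R′ → T ↭ T′ → Γ ↭ Γ′ → Δ ↭ Δ′ → Prov C (mkSeq R′ T′ Γ′ Δ′)
  rename : ∀ {S} (f : ℕ ↔ ℕ) → Prov C S → Prov C (renameSeq (Inverse.to f) S)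

  ax : ∀ {R T Γ Δ w u p ts} → Reach R w u →
       Prov C (mkSeq R T ((w , pred p ts) ∷ Γ) ((u , pred p ts) ∷ Δ))
  botL : ∀ {R T Γ Δ w} → Prov C (mkSeq R T ((w , bot) ∷ Γ) Δ)
  topR : ∀ {R T Γ Δ w} → Prov C (mkSeq R T Γ ((w , top) ∷ Δ))
  andL : ∀ {R T Γ Δ w φ ψ} →
         Prov C (mkSeq R T ((w , φ) ∷ (w , ψ) ∷ Γ) Δ) →
         Prov C (mkSeq R T ((w , and φ ψ) ∷ Γ) Δ)
  andR : ∀ {R T Γ Δ w φ ψ} →
         Prov C (mkSeq R T Γ ((w , φ) ∷ Δ)) →
         Prov C (mkSeq R T Γ ((w , ψ) ∷ Δ)) →
         Prov C (mkSeq R T Γ ((w , and φ ψ) ∷ Δ))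
  orL : ∀ {R T Γ Δ w φ ψ} →
        Prov C (mkSeq R T ((w , φ) ∷ Γ) Δ) →
        Prov C (mkSeq R T ((w , ψ) ∷ Γ) Δ) →
        Prov C (mkSeq R T ((w , or φ ψ) ∷ Γ) Δ)
  orR : ∀ {R T Γ Δ w φ ψ} →
        Prov C (mkSeq R T Γ ((w , φ) ∷ (w , ψ) ∷ Δ)) →
        Prov C (mkSeq R T Γ ((w , or φ ψ) ∷ Δ))
  impL : ∀ {R T Γ Δ w u φ ψ} → Reach R w u →
         Prov C (mkSeq R T ((w , imp φ ψ) ∷ Γ) ((u , φ) ∷ Δ)) →
         Prov C (mkSeq R T ((u , ψ) ∷ (w , imp φ ψ) ∷ Γ) Δ) →
         Prov C (mkSeq R T ((w , imp φ ψ) ∷ Γ) Δ)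
  impR : ∀ {R T Γ Δ w u φ ψ} →
         u ∉ labels (mkSeq R T Γ ((w , imp φ ψ) ∷ Δ)) →
         Prov C (mkSeq ((w , u) ∷ R) T ((u , φ) ∷ Γ) ((u , ψ) ∷ Δ)) →
         Prov C (mkSeq R T Γ ((w , imp φ ψ) ∷ Δ))
  exclL : ∀ {R T Γ Δ w u φ ψ} →
          u ∉ labels (mkSeq R T ((w , excl φ ψ) ∷ Γ) Δ) →
          Prov C (mkSeq ((u , w) ∷ R) T ((u , φ) ∷ Γ) ((u , ψ) ∷ Δ)) →
          Prov C (mkSeq R T ((w , excl φ ψ) ∷ Γ) Δ)
  exclR : ∀ {R T Γ Δ w u φ ψ} → Reach R w u →
          Prov C (mkSeq R T Γ ((u , excl φ ψ) ∷ (w , φ) ∷ Δ)) →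
          Prov C (mkSeq R T ((w , ψ) ∷ Γ) ((u , excl φ ψ) ∷ Δ)) →
          Prov C (mkSeq R T Γ ((u , excl φ ψ) ∷ Δ))
  exL : ∀ {R T Γ Δ w x y φ} →
        y ∉ vars (mkSeq R T ((w , ex x φ) ∷ Γ) Δ) →
        Prov C (mkSeq R ((w , y) ∷ T) ((w , φ [ var y / x ]) ∷ Γ) Δ) →
        Prov C (mkSeq R T ((w , ex x φ) ∷ Γ) Δ)
  exR : ∀ {R T Γ Δ w x φ} (t : Term) → TermOK C R T w t →
        Prov C (mkSeq R T Γ ((w , ex x φ) ∷ (w , φ [ t / x ]) ∷ Δ)) →
        Prov C (mkSeq R T Γ ((w , ex x φ) ∷ Δ))
  faL : ∀ {R T Γ Δ w u x φ} (t : Term) → Reach R w u → TermOK C R T u t →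
        Prov C (mkSeq R T ((w , fa x φ) ∷ (u , φ [ t / x ]) ∷ Γ) Δ) →
        Prov C (mkSeq R T ((w , fa x φ) ∷ Γ) Δ)
  faR : ∀ {R T Γ Δ w u x y φ} →
        u ∉ labels (mkSeq R T Γ ((w , fa x φ) ∷ Δ)) →
        y ∉ vars (mkSeq R T Γ ((w , fa x φ) ∷ Δ)) →
        Prov C (mkSeq ((w , u) ∷ R) ((u , y) ∷ T) Γ ((u , φ [ var y / x ]) ∷ Δ)) →
        Prov C (mkSeq R T Γ ((w , fa x φ) ∷ Δ))
  ds : ∀ {R T Γ Δ w p ts} → C ≡ ID →
       Prov C (mkSeq R (map (λ x → (w , x)) (VTs ts) ++ T) ((w , pred p ts) ∷ Γ) Δ) →
       Prov C (mkSeq R T ((w , pred p ts) ∷ Γ) Δ)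

{-# OPTIONS --safe #-}
module Submission where

-- Cuts are eliminated in a cumulative variant of LBIQ(C), where formulae are
-- never discarded, by induction on the size of the cut formula and on the two
-- derivations.  Each derivation comes with an embedding of its end sequent into
-- the sequent to be derived, which relabels, substitutes terms, renames bound
-- variables and moves left formulae up and right formulae down along
-- reachability; so no structural lemma has to preserve heights, and an
-- eigenlabel or eigenvariable is simply sent to the label or term that the
-- opposite rule uses.  Only reachability in R matters, hence merging labels is
-- harmless even though it destroys the tree shape.  A cumulative derivation is
-- turned back into one of LBIQ(C) by embedding it into the set of formulae that
-- are present or have already been decomposed.

open import Defs
open import Data.Nat using (ℕ; suc; _≡ᵇ_; _≤_; _<_; _+_; s≤s)
open import Data.Nat.Properties using (_≟_; ≡ᵇ⇒≡; ≡⇒≡ᵇ; m≤m⊔n; m≤n⊔m; ≤-trans; ≤-reflexive; <-irrefl; m≤m+n; m≤n+m)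
open import Data.Nat.Induction using (<-rec)
open import Data.Bool using (true; false; if_then_else_) renaming (T to IsTrue)
open import Data.List using (List; []; _∷_; _++_; map; concatMap)
open import Data.List.Properties using (map-++; map-∘; concatMap-map; concatMap-++)
open import Data.List.Membership.Propositional using (_∈_; _∉_)
open import Data.List.Membership.Propositional.Properties
  using (∈-++⁺ˡ; ∈-++⁺ʳ; ∈-++⁻; ∈-map⁺; ∈-∃++; ∈-concat⁺′)
open import Data.List.Relation.Binary.Subset.Propositional using (_⊆_)
open import Data.List.Relation.Binary.Permutation.Propositional using (_↭_; ↭-refl; ↭-sym)
open import Data.List.Relation.Binary.Permutation.Propositional.Properties using (∈-resp-↭; shift)
open import Data.List.Relation.Unary.Any using (here; there)
open import Data.List.Relation.Unary.All using (All; []; _∷_; lookup; tabulate)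
import Data.List.Relation.Unary.All as All
import Data.List.Relation.Unary.All.Properties as Allₚ
open import Data.Product using (_×_; _,_; proj₁; proj₂; ∃-syntax)
open import Data.Sum using (_⊎_; inj₁; inj₂; [_,_]′)
open import Data.Unit using (tt)
open import Function using (_∘_; id)
open import Relation.Nullary using (yes; no; contradiction)
open import Relation.Binary.PropositionalEquality
  using (_≡_; _≢_; refl; sym; trans; cong; cong₂; subst; subst₂; module ≡-Reasoning)

private variable
  A : Set
  x y z : Var
  ρ ρ′ ρ″ σ : Var → Term
  φ ψ χ : Formula

-- Lists, updates of functions and fresh names.

skip₂ : ∀ {a b : A} {xs} → xs ⊆ a ∷ b ∷ xs
skip₂ p = there (there p)

insert₂ : ∀ {a b : A} {xs} → a ∷ xs ⊆ a ∷ b ∷ xs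
insert₂ (here e)  = here e
insert₂ (there p) = there (there p)

-- At terms this unfolds to the same expression as `upd`, so the two lemmas below serve both
-- substitutions and relabellings.
override : (ℕ → A) → ℕ → A → ℕ → A
override f y a v = if v ≡ᵇ y then a else f v

override-same : (f : ℕ → A) (y : ℕ) (a : A) → override f y a y ≡ a
override-same f y a with y ≡ᵇ y in eq
... | true  = refl
... | false with () ← subst IsTrue eq (≡⇒≡ᵇ y y refl)

override-other : (f : ℕ → A) {y v : ℕ} (a : A) → v ≢ y → override f y a v ≡ f v
override-other f {y} {v} a v≢y with v ≡ᵇ y in eq
... | true  = contradiction (≡ᵇ⇒≡ v y (subst IsTrue (sym eq) tt)) v≢y
... | false = refl

∈-maxL : ∀ {v xs} → v ∈ xs → v ≤ maxL xs
∈-maxL {xs = x ∷ xs} (here refl) = m≤m⊔n x (maxL xs)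
∈-maxL {xs = x ∷ xs} (there p)   = ≤-trans (∈-maxL p) (m≤n⊔m x (maxL xs))

fresh : List ℕ → ℕ
fresh xs = suc (maxL xs)

fresh-∉ : ∀ xs → fresh xs ∉ xs
fresh-∉ xs p = <-irrefl refl (∈-maxL p)

memb-false : ∀ {v} xs → memb v xs ≡ false → v ∉ xs
memb-false {v} (x ∷ xs) eq p with v ≡ᵇ x in q
memb-false {v} (x ∷ xs) () p         | true
memb-false {v} (x ∷ xs) eq (here refl) | false with () ← subst IsTrue q (≡⇒≡ᵇ v v refl)
memb-false {v} (x ∷ xs) eq (there p) | false = memb-false xs eq p

∈-remove⁺ : ∀ {v xs} → v ∈ xs → v ≢ y → v ∈ remove y xs
∈-remove⁺ {y = y} {xs = x ∷ xs} (here refl) v≢y with y ≡ᵇ x in eq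
... | true  = contradiction (sym (≡ᵇ⇒≡ y x (subst IsTrue (sym eq) tt))) v≢y
... | false = here refl
∈-remove⁺ {y = y} {xs = x ∷ xs} (there p) v≢y with y ≡ᵇ x
... | true  = ∈-remove⁺ p v≢y
... | false = there (∈-remove⁺ p v≢y)

remove-⊆ : ∀ y xs → remove y xs ⊆ xs
remove-⊆ y (x ∷ xs) p with y ≡ᵇ x
remove-⊆ y (x ∷ xs) p         | true  = there (remove-⊆ y xs p)
remove-⊆ y (x ∷ xs) (here eq) | false = here eq
remove-⊆ y (x ∷ xs) (there p) | false = there (remove-⊆ y xs p)

∈-++-map : ∀ {v : ℕ} {xs ys xs′ ys′} → xs ⊆ xs′ → ys ⊆ ys′ → v ∈ xs ++ ys → v ∈ xs′ ++ ys′
∈-++-map {xs = xs} {xs′ = xs′} p q = [ ∈-++⁺ˡ ∘ p , ∈-++⁺ʳ xs′ ∘ q ]′ ∘ ∈-++⁻ xs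

-- Eigenvariable conditions speak of `AllVars`, whereas the effect of a substitution depends on `FV`
-- alone.
FV⊆AllVars : ∀ φ → FV φ ⊆ AllVars φ
FV⊆AllVars (pred p ts) = id
FV⊆AllVars bot         = id
FV⊆AllVars top         = id
FV⊆AllVars (and φ ψ)   = ∈-++-map {xs = FV φ} (FV⊆AllVars φ) (FV⊆AllVars ψ)
FV⊆AllVars (or φ ψ)    = ∈-++-map {xs = FV φ} (FV⊆AllVars φ) (FV⊆AllVars ψ)
FV⊆AllVars (excl φ ψ)  = ∈-++-map {xs = FV φ} (FV⊆AllVars φ) (FV⊆AllVars ψ)
FV⊆AllVars (imp φ ψ)   = ∈-++-map {xs = FV φ} (FV⊆AllVars φ) (FV⊆AllVars ψ)
FV⊆AllVars (ex x φ)    = there ∘ FV⊆AllVars φ ∘ remove-⊆ x (FV φ)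
FV⊆AllVars (fa x φ)    = there ∘ FV⊆AllVars φ ∘ remove-⊆ x (FV φ)

-- Substitution and alpha-equality.

_⊙_ : (Var → Term) → (Var → Term) → Var → Term
(ρ ⊙ σ) v = substT ρ (σ v)

mutual
  substT-cong : ∀ t → (∀ {v} → v ∈ VT t → ρ v ≡ ρ′ v) → substT ρ t ≡ substT ρ′ t
  substT-cong (var x)    h = h (here refl)
  substT-cong (fun f ts) h = cong (fun f) (substTs-cong ts h)

  substTs-cong : ∀ ts → (∀ {v} → v ∈ VTs ts → ρ v ≡ ρ′ v) → substTs ρ ts ≡ substTs ρ′ ts
  substTs-cong []       h = refl
  substTs-cong (t ∷ ts) h =
    cong₂ _∷_ (substT-cong t (h ∘ ∈-++⁺ˡ)) (substTs-cong ts (h ∘ ∈-++⁺ʳ (VT t)))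

mutual
  substT-⊙ : ∀ t → substT ρ (substT σ t) ≡ substT (ρ ⊙ σ) t
  substT-⊙ (var x)    = refl
  substT-⊙ (fun f ts) = cong (fun f) (substTs-⊙ ts)

  substTs-⊙ : ∀ ts → substTs ρ (substTs σ ts) ≡ substTs (ρ ⊙ σ) ts
  substTs-⊙ []       = refl
  substTs-⊙ (t ∷ ts) = cong₂ _∷_ (substT-⊙ t) (substTs-⊙ ts)

mutual
  substT-var : ∀ t → substT var t ≡ t
  substT-var (var x)    = refl
  substT-var (fun f ts) = cong (fun f) (substTs-var ts)

  substTs-var : ∀ ts → substTs var ts ≡ ts
  substTs-var []       = refl
  substTs-var (t ∷ ts) = cong₂ _∷_ (substT-var t) (substTs-var ts)

-- Alpha-equality of the closures (ρ , φ) and (ρ′ , φ′).  Bound variables are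
-- instantiated by all terms, so no fresh names are needed.
data Same : (Var → Term) → Formula → (Var → Term) → Formula → Set where
  pred : ∀ {p ts ts′} → substTs ρ ts ≡ substTs ρ′ ts′ → Same ρ (pred p ts) ρ′ (pred p ts′)
  bot  : Same ρ bot ρ′ bot
  top  : Same ρ top ρ′ top
  and  : ∀ {φ′ ψ′} → Same ρ φ ρ′ φ′ → Same ρ ψ ρ′ ψ′ → Same ρ (and φ ψ) ρ′ (and φ′ ψ′)
  or   : ∀ {φ′ ψ′} → Same ρ φ ρ′ φ′ → Same ρ ψ ρ′ ψ′ → Same ρ (or φ ψ) ρ′ (or φ′ ψ′)
  excl : ∀ {φ′ ψ′} → Same ρ φ ρ′ φ′ → Same ρ ψ ρ′ ψ′ → Same ρ (excl φ ψ) ρ′ (excl φ′ ψ′)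
  imp  : ∀ {φ′ ψ′} → Same ρ φ ρ′ φ′ → Same ρ ψ ρ′ ψ′ → Same ρ (imp φ ψ) ρ′ (imp φ′ ψ′)
  ex   : ∀ {φ′} → (∀ t → Same (upd ρ x t) φ (upd ρ′ y t) φ′) → Same ρ (ex x φ) ρ′ (ex y φ′)
  fa   : ∀ {φ′} → (∀ t → Same (upd ρ x t) φ (upd ρ′ y t) φ′) → Same ρ (fa x φ) ρ′ (fa y φ′)

same-sym : Same ρ φ ρ′ ψ → Same ρ′ ψ ρ φ
same-sym (pred e)   = pred (sym e)
same-sym bot        = bot
same-sym top        = top
same-sym (and p q)  = and (same-sym p) (same-sym q)
same-sym (or p q)   = or (same-sym p) (same-sym q)
same-sym (excl p q) = excl (same-sym p) (same-sym q)
same-sym (imp p q)  = imp (same-sym p) (same-sym q)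
same-sym (ex h)     = ex (λ t → same-sym (h t))
same-sym (fa h)     = fa (λ t → same-sym (h t))

same-trans : Same ρ φ ρ′ ψ → Same ρ′ ψ ρ″ χ → Same ρ φ ρ″ χ
same-trans (pred e)   (pred e′)    = pred (trans e e′)
same-trans bot        bot          = bot
same-trans top        top          = top
same-trans (and p q)  (and p′ q′)  = and (same-trans p p′) (same-trans q q′)
same-trans (or p q)   (or p′ q′)   = or (same-trans p p′) (same-trans q q′)
same-trans (excl p q) (excl p′ q′) = excl (same-trans p p′) (same-trans q q′)
same-trans (imp p q)  (imp p′ q′)  = imp (same-trans p p′) (same-trans q q′)
same-trans (ex h)     (ex h′)      = ex (λ t → same-trans (h t) (h′ t))
same-trans (fa h)     (fa h′)      = fa (λ t → same-trans (h t) (h′ t))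

upd-cong : ∀ φ {t} → (∀ {v} → v ∈ remove y (FV φ) → ρ v ≡ ρ′ v) →
           ∀ {v} → v ∈ FV φ → upd ρ y t v ≡ upd ρ′ y t v
upd-cong {y = y} {ρ} {ρ′} φ {t} h {v} p with v ≟ y
... | yes refl = trans (override-same ρ y t) (sym (override-same ρ′ y t))
... | no v≢y   = trans (override-other ρ t v≢y)
                   (trans (h (∈-remove⁺ p v≢y)) (sym (override-other ρ′ t v≢y)))

same-ext : ∀ φ → (∀ {v} → v ∈ FV φ → ρ v ≡ ρ′ v) → Same ρ φ ρ′ φ
same-ext (pred p ts) h = pred (substTs-cong ts h)
same-ext bot         h = bot
same-ext top         h = top
same-ext (and φ ψ)   h = and (same-ext φ (h ∘ ∈-++⁺ˡ)) (same-ext ψ (h ∘ ∈-++⁺ʳ (FV φ)))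
same-ext (or φ ψ)    h = or (same-ext φ (h ∘ ∈-++⁺ˡ)) (same-ext ψ (h ∘ ∈-++⁺ʳ (FV φ)))
same-ext (excl φ ψ)  h = excl (same-ext φ (h ∘ ∈-++⁺ˡ)) (same-ext ψ (h ∘ ∈-++⁺ʳ (FV φ)))
same-ext (imp φ ψ)   h = imp (same-ext φ (h ∘ ∈-++⁺ˡ)) (same-ext ψ (h ∘ ∈-++⁺ʳ (FV φ)))
same-ext (ex x φ)    h = ex (λ t → same-ext φ (upd-cong φ h))
same-ext (fa x φ)    h = fa (λ t → same-ext φ (upd-cong φ h))

same-refl : Same ρ φ ρ φ
same-refl = same-ext _ λ _ → refl

-- Either the membership test has failed for `y`, or the choice exceeds every variable to be
-- avoided.
pickBound-∉ : ∀ σ y φ → pickBound σ y φ ∉ concatMap (VT ∘ σ) (remove y (FV φ))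
pickBound-∉ σ y φ with memb y (concatMap (VT ∘ σ) (remove y (FV φ))) in eq
... | true  = fresh-∉ _
... | false = memb-false _ eq

-- This is where capture is excluded: as `z` occurs in no `σ v` for the other free variables `v`, a
-- later update at `z` is seen only through `y`.
upd-⊙ : ∀ {ρ σ y z t} φ → z ∉ concatMap (VT ∘ σ) (remove y (FV φ)) →
        ∀ {v} → v ∈ FV φ → (upd ρ z t ⊙ upd σ y (var z)) v ≡ upd (ρ ⊙ σ) y t v
upd-⊙ {ρ} {σ} {y} {z} {t} φ z∉ {v} p with v ≟ y
... | yes refl = begin
  substT (upd ρ z t) (upd σ y (var z) y) ≡⟨ cong (substT _) (override-same σ y (var z)) ⟩
  upd ρ z t z                            ≡⟨ override-same ρ z t ⟩
  t                                      ≡⟨ override-same (ρ ⊙ σ) y t ⟨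
  upd (ρ ⊙ σ) y t y                      ∎
  where open ≡-Reasoning
... | no v≢y = begin
  substT (upd ρ z t) (upd σ y (var z) v) ≡⟨ cong (substT _) (override-other σ (var z) v≢y) ⟩
  substT (upd ρ z t) (σ v)               ≡⟨ substT-cong (σ v) (λ q → override-other ρ t λ where
                                              refl → z∉ (∈-concat⁺′ q (∈-map⁺ (VT ∘ σ) (∈-remove⁺ p v≢y)))) ⟩
  substT ρ (σ v)                         ≡⟨ override-other (ρ ⊙ σ) t v≢y ⟨
  upd (ρ ⊙ σ) y t v                      ∎
  where open ≡-Reasoning

-- A syntactic substitution can be absorbed into the environment. At a binder the renamed variable
-- receives the same term `t` as the original one, and `upd-⊙` compares the two environments.
same-subst : ∀ φ {σ ρ} → Same ρ (substF σ φ) (ρ ⊙ σ) φ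
same-subst (pred p ts) = pred (substTs-⊙ ts)
same-subst bot         = bot
same-subst top         = top
same-subst (and φ ψ)   = and (same-subst φ) (same-subst ψ)
same-subst (or φ ψ)    = or (same-subst φ) (same-subst ψ)
same-subst (excl φ ψ)  = excl (same-subst φ) (same-subst ψ)
same-subst (imp φ ψ)   = imp (same-subst φ) (same-subst ψ)
same-subst (ex y φ) {σ} {ρ} = ex λ t →
  same-trans (same-subst φ) (same-ext φ (upd-⊙ {ρ} {σ} φ (pickBound-∉ σ y φ)))
same-subst (fa y φ) {σ} {ρ} = fa λ t →
  same-trans (same-subst φ) (same-ext φ (upd-⊙ {ρ} {σ} φ (pickBound-∉ σ y φ)))

-- Both instances are absorbed into the environments, where the bound variables stand for
-- `substT ρ t` and `substT ρ′ t′`. These are one term, at which the hypothesis on bodies applies.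
same-inst : ∀ {φ′} t → (∀ t → Same (upd ρ x t) φ (upd ρ′ y t) φ′) →
            ∀ {t′} → substT ρ t ≡ substT ρ′ t′ → Same ρ (φ [ t / x ]) ρ′ (φ′ [ t′ / y ])
same-inst {ρ} {x} {φ} {ρ′} {y} {φ′} t h {t′} e =
  same-trans (same-subst φ) (same-trans (same-ext φ λ {v} _ → inst ρ x t v)
    (same-trans (h (substT ρ t)) (same-sym (same-trans (same-subst φ′) (same-ext φ′ λ {v} _ →
      trans (inst ρ′ y t′ v) (cong (λ t → upd ρ′ y t v) (sym e)))))))
  where
  inst : ∀ ρ x t v → (ρ ⊙ upd var x t) v ≡ upd ρ x (substT ρ t) v
  inst ρ x t v with v ≡ᵇ x
  ... | true  = refl
  ... | false = refl

-- Allows an eigenvariable to be sent to an arbitrary term.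
same-fresh : ∀ {φ′ t} → y ∉ AllVars φ → Same ρ φ ρ′ φ′ → Same (upd ρ y t) φ ρ′ φ′
same-fresh {φ = φ} {ρ = ρ} {t = t} y∉ s = same-trans
  (same-ext φ λ p → override-other ρ t λ { refl → y∉ (FV⊆AllVars φ p) }) s

-- The measure on cut formulae.

size : Formula → ℕ
size (pred p ts) = 0
size bot         = 0
size top         = 0
size (and φ ψ)   = suc (size φ + size ψ)
size (or φ ψ)    = suc (size φ + size ψ)
size (excl φ ψ)  = suc (size φ + size ψ)
size (imp φ ψ)   = suc (size φ + size ψ)
size (ex x φ)    = suc (size φ)
size (fa x φ)    = suc (size φ)

-- Terms do not contribute to the size, so every instance of a quantified formula is smaller than
-- that formula.
size-subst : ∀ φ {σ} → size (substF σ φ) ≡ size φ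
size-subst (pred p ts) = refl
size-subst bot         = refl
size-subst top         = refl
size-subst (and φ ψ)   = cong suc (cong₂ _+_ (size-subst φ) (size-subst ψ))
size-subst (or φ ψ)    = cong suc (cong₂ _+_ (size-subst φ) (size-subst ψ))
size-subst (excl φ ψ)  = cong suc (cong₂ _+_ (size-subst φ) (size-subst ψ))
size-subst (imp φ ψ)   = cong suc (cong₂ _+_ (size-subst φ) (size-subst ψ))
size-subst (ex x φ)    = cong suc (size-subst φ)
size-subst (fa x φ)    = cong suc (size-subst φ)

-- The cumulative calculus.

data Side : Set where
  lhs rhs : Side

SFormula : Set
SFormula = Side × LFormula

record Context : Set where
  constructor ctx
  field
    rels : List RelAtom
    doms : List DomAtom
    fmls : List SFormula

open Context

_⊕_ : Context → Context → Context
E ⊕ S = ctx (rels E ++ rels S) (doms E ++ doms S) (fmls E ++ fmls S)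

clabels : Context → List Label
clabels (ctx R T Φ) = verts R ++ map proj₁ T ++ map (proj₁ ∘ proj₂) Φ

cvars : Context → List Var
cvars (ctx R T Φ) = map proj₂ T ++ concatMap (AllVars ∘ proj₂ ∘ proj₂) Φ

forms : List SFormula → Context
forms = ctx [] []

-- `Rule C S X Es`: the principal formula X of S has the premises E ⊕ S, for
-- E in Es.
data Rule (C : Calc) (S : Context) : SFormula → List Context → Set where
  botL  : ∀ {w} → Rule C S (lhs , w , bot) []
  topR  : ∀ {w} → Rule C S (rhs , w , top) []
  andL  : ∀ {w φ ψ} → Rule C S (lhs , w , and φ ψ) (forms ((lhs , w , φ) ∷ (lhs , w , ψ) ∷ []) ∷ [])
  andR  : ∀ {w φ ψ} → Rule C S (rhs , w , and φ ψ) (forms ((rhs , w , φ) ∷ []) ∷ forms ((rhs , w , ψ) ∷ []) ∷ [])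
  orL   : ∀ {w φ ψ} → Rule C S (lhs , w , or φ ψ) (forms ((lhs , w , φ) ∷ []) ∷ forms ((lhs , w , ψ) ∷ []) ∷ [])
  orR   : ∀ {w φ ψ} → Rule C S (rhs , w , or φ ψ) (forms ((rhs , w , φ) ∷ (rhs , w , ψ) ∷ []) ∷ [])
  impL  : ∀ {w u φ ψ} → Reach (rels S) w u →
          Rule C S (lhs , w , imp φ ψ) (forms ((rhs , u , φ) ∷ []) ∷ forms ((lhs , u , ψ) ∷ []) ∷ [])
  impR  : ∀ {w u φ ψ} → u ∉ clabels S →
          Rule C S (rhs , w , imp φ ψ) (ctx ((w , u) ∷ []) [] ((lhs , u , φ) ∷ (rhs , u , ψ) ∷ []) ∷ [])
  exclL : ∀ {w u φ ψ} → u ∉ clabels S →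
          Rule C S (lhs , w , excl φ ψ) (ctx ((u , w) ∷ []) [] ((lhs , u , φ) ∷ (rhs , u , ψ) ∷ []) ∷ [])
  exclR : ∀ {w u φ ψ} → Reach (rels S) w u →
          Rule C S (rhs , u , excl φ ψ) (forms ((rhs , w , φ) ∷ []) ∷ forms ((lhs , w , ψ) ∷ []) ∷ [])
  exL   : ∀ {w x y φ} → y ∉ cvars S →
          Rule C S (lhs , w , ex x φ) (ctx [] ((w , y) ∷ []) ((lhs , w , φ [ var y / x ]) ∷ []) ∷ [])
  exR   : ∀ {w x φ} t → TermOK C (rels S) (doms S) w t →
          Rule C S (rhs , w , ex x φ) (forms ((rhs , w , φ [ t / x ]) ∷ []) ∷ [])
  faL   : ∀ {w u x φ} t → Reach (rels S) w u → TermOK C (rels S) (doms S) u t →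
          Rule C S (lhs , w , fa x φ) (forms ((lhs , u , φ [ t / x ]) ∷ []) ∷ [])
  faR   : ∀ {w u x y φ} → u ∉ clabels S → y ∉ cvars S →
          Rule C S (rhs , w , fa x φ) (ctx ((w , u) ∷ []) ((u , y) ∷ []) ((rhs , u , φ [ var y / x ]) ∷ []) ∷ [])
  ds    : ∀ {w p ts} → C ≡ ID →
          Rule C S (lhs , w , pred p ts) (ctx [] (map (w ,_) (VTs ts)) [] ∷ [])

-- The cumulative variant of LBIQ(C), where principal formulae are kept: here
-- contraction is built in and no rule needs to be inverted to eliminate cuts.
data Deriv (C : Calc) (S : Context) : Set where
  ax   : ∀ {w u p ts} → (lhs , w , pred p ts) ∈ fmls S → (rhs , u , pred p ts) ∈ fmls S →
         Reach (rels S) w u → Deriv C S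
  step : ∀ {X Es} → X ∈ fmls S → Rule C S X Es → (∀ {E} → E ∈ Es → Deriv C (E ⊕ S)) → Deriv C S

-- Reachability and availability of terms.

private variable
  C : Calc
  R R′ : List RelAtom
  T T′ : List DomAtom
  Γ Δ Γ′ Δ′ : List LFormula
  w u v k : Label
  t : Term
  S S₁ S₂ E : Context
  f : Label → Label
  M M′ : SFormula → Set

reach-trans : Reach R w u → Reach R u v → Reach R w v
reach-trans here        q = q
reach-trans (there e p) q = there e (reach-trans p q)

reach-edge : (w , u) ∈ R → Reach R w u
reach-edge e = there e here

reach-bind : (∀ {a b} → (a , b) ∈ R → Reach R′ (f a) (f b)) → Reach R w u → Reach R′ (f w) (f u)
reach-bind h here        = here
reach-bind h (there e p) = reach-trans (h e) (reach-bind h p)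

reach-mono : R ⊆ R′ → Reach R w u → Reach R′ w u
reach-mono h = reach-bind (reach-edge ∘ h)

termOK-mono : ∀ C → R ⊆ R′ → T ⊆ T′ → TermOK C R T w t → TermOK C R′ T′ w t
termOK-mono ID r d = All.map λ (v , m , p) → v , d m , reach-mono r p
termOK-mono CD r d _ = tt

termOK-reach : ∀ C → Reach R w u → TermOK C R T w t → TermOK C R T u t
termOK-reach ID q = All.map λ (v , m , p) → v , m , reach-trans p q
termOK-reach CD q _ = tt

mutual
  all-substT : ∀ {P : Var → Set} t → All (λ x → All P (VT (σ x))) (VT t) → All P (VT (substT σ t))
  all-substT (var x)    (p ∷ []) = p
  all-substT (fun f ts) ps       = all-substTs ts ps

  all-substTs : ∀ {P : Var → Set} ts → All (λ x → All P (VT (σ x))) (VTs ts) → All P (VTs (substTs σ ts))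
  all-substTs []       ps = []
  all-substTs (t ∷ ts) ps =
    Allₚ.++⁺ (all-substT t (Allₚ.++⁻ˡ (VT t) ps)) (all-substTs ts (Allₚ.++⁻ʳ (VT t) ps))

-- Used for `ds`, where availability must be read back from a substituted list of arguments to the
-- images of its variables.
mutual
  all-substT⁻ : ∀ {P : Var → Set} t → All P (VT (substT σ t)) → All (λ x → All P (VT (σ x))) (VT t)
  all-substT⁻ (var x)    p  = p ∷ []
  all-substT⁻ (fun f ts) ps = all-substTs⁻ ts ps

  all-substTs⁻ : ∀ {P : Var → Set} ts → All P (VTs (substTs σ ts)) → All (λ x → All P (VT (σ x))) (VTs ts)
  all-substTs⁻ []       ps = []
  all-substTs⁻ {σ = σ} (t ∷ ts) ps =
    Allₚ.++⁺ (all-substT⁻ t (Allₚ.++⁻ˡ (VT (substT σ t)) ps))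
             (all-substTs⁻ ts (Allₚ.++⁻ʳ (VT (substT σ t)) ps))

-- Embeddings of contexts.

Persist : Side → List RelAtom → Label → Label → Set
Persist lhs R v w = Reach R v w
Persist rhs R v w = Reach R w v

persist-mono : ∀ s → R ⊆ R′ → Persist s R v w → Persist s R′ v w
persist-mono lhs = reach-mono
persist-mono rhs = reach-mono

persist-here : ∀ s → Persist s R v v
persist-here lhs = here
persist-here rhs = here

-- A left formula stands in for its copies at higher labels, a right formula for its copies at lower
-- ones. `M` is a predicate so that the target can be a list, a list together with a cut formula, or
-- the covered formulae of a sequent.
record Match (f : Label → Label) (σ : Var → Term) (R : List RelAtom) (M : SFormula → Set)
             (X : SFormula) : Set where
  constructor match
  field
    {place}   : Label
    {formula} : Formula
    mem       : M (proj₁ X , place , formula)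
    persist   : Persist (proj₁ X) R place (f (proj₁ (proj₂ X)))
    same      : Same σ (proj₂ (proj₂ X)) var formula

match-mono : R ⊆ R′ → (∀ {X} → M X → M′ X) → ∀ {X} → Match f σ R M X → Match f σ R′ M′ X
match-mono r m {X} (match p d s) = match (m p) (persist-mono (proj₁ X) r d) s

-- S embeds, after relabelling by f and substituting by σ, into a sequent with
-- atoms R, T whose formulae satisfy M.  This subsumes weakening, merging of
-- labels, term substitution and alpha-conversion.
record Embed (C : Calc) (f : Label → Label) (σ : Var → Term) (S : Context)
             (R : List RelAtom) (T : List DomAtom) (M : SFormula → Set) : Set where
  constructor embed
  field
    rel : All (λ e → Reach R (f (proj₁ e)) (f (proj₂ e))) (rels S)
    dom : All (λ d → TermOK C R T (f (proj₁ d)) (σ (proj₂ d))) (doms S)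
    fml : All (Match f σ R M) (fmls S)

open Embed

embed-mono : R ⊆ R′ → T ⊆ T′ → (∀ {X} → M X → M′ X) → Embed C f σ S R T M → Embed C f σ S R′ T′ M′
embed-mono {C = C} r d m (embed rs os ms) =
  embed (All.map (reach-mono r) rs) (All.map (termOK-mono C r d) os) (All.map (match-mono r m) ms)

embed-⊕ : Embed C f σ E R T M → Embed C f σ S R T M → Embed C f σ (E ⊕ S) R T M
embed-⊕ (embed r d m) (embed r′ d′ m′) = embed (Allₚ.++⁺ r r′) (Allₚ.++⁺ d d′) (Allₚ.++⁺ m m′)

embed-forms : ∀ {Φ} → All (Match f σ R M) Φ → Embed C f σ S R T M → Embed C f σ (forms Φ ⊕ S) R T M
embed-forms ms = embed-⊕ (embed [] [] ms)

termOK-var : ∀ C → (w , x) ∈ T → TermOK C R T w (var x)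
termOK-var ID q = (_ , q , here) ∷ []
termOK-var CD _ = tt

embed-id : R ⊆ R′ → T ⊆ T′ → ∀ {Φ} → (∀ {X} → X ∈ Φ → M X) → Embed C id var (ctx R T Φ) R′ T′ M
embed-id {T = T} {C = C} r d m = embed
  (tabulate (reach-edge ∘ r))
  (tabulate (λ q → termOK-var C (d q)))
  (tabulate (λ {X} q → match (m q) (persist-here (proj₁ X)) same-refl))

embed-reach : Embed C f σ S R T M → Reach (rels S) w u → Reach R (f w) (f u)
embed-reach e = reach-bind (lookup (rel e))

-- Each variable `x` of `t` comes from an atom at some `v` below `w`. Its image `σ x` is available
-- at `f v`, hence at `f w`, and `all-substT` collects these facts.
embed-termOK : ∀ C → Embed C f σ S R T M → TermOK C (rels S) (doms S) w t → TermOK C R T (f w) (substT σ t)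
embed-termOK {σ = σ} {t = t} ID e ok = all-substT t
  (All.map (λ {x} (v , m , p) → termOK-reach {t = σ x} ID (embed-reach e p) (lookup (dom e) m)) ok)
embed-termOK CD e ok = tt

∈-verts : (w , u) ∈ R → w ∈ verts R × u ∈ verts R
∈-verts (here refl) = here refl , there (here refl)
∈-verts (there p)   = let (q , r) = ∈-verts p in there (there q) , there (there r)

∈-clabels : ∀ {s} → (s , w , φ) ∈ fmls S → w ∈ clabels S
∈-clabels {S = S} p = ∈-++⁺ʳ (verts (rels S)) (∈-++⁺ʳ (map proj₁ (doms S)) (∈-map⁺ (proj₁ ∘ proj₂) p))

-- The relabelling changes only at a label absent from `S`; an eigenlabel may therefore be sent to
-- any `k`.
embed-relabel : u ∉ clabels S → ∀ k → Embed C f σ S R T M → Embed C (override f u k) σ S R T M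
embed-relabel {u} {S} {C} {f} {σ} {R} {T} {M} u∉ k e = embed
  (tabulate λ p → let (q , r) = ∈-verts p in
    subst₂ (Reach R) (keep (∈-++⁺ˡ q)) (keep (∈-++⁺ˡ r)) (lookup (rel e) p))
  (tabulate λ {d} p → subst (λ a → TermOK C R T a (σ (proj₂ d)))
    (keep (∈-++⁺ʳ (verts (rels S)) (∈-++⁺ˡ (∈-map⁺ proj₁ p)))) (lookup (dom e) p))
  (tabulate λ {X} p → let match m d s = lookup (fml e) p in
    match m (subst (Persist (proj₁ X) R _) (keep (∈-clabels {S = S} p)) d) s)
  where
  keep : ∀ {a} → a ∈ clabels S → f a ≡ override f u k a
  keep p = sym (override-other f k λ { refl → u∉ p })

embed-upd : y ∉ cvars S → ∀ t → Embed C f σ S R T M → Embed C f (upd σ y t) S R T M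
embed-upd {y} {S} {C} {f} {σ} {R} {T} y∉ t e = embed
  (rel e)
  (tabulate λ {d} p → subst (TermOK C R T (f (proj₁ d)))
    (sym (override-other σ t λ { refl → y∉ (∈-++⁺ˡ (∈-map⁺ proj₂ p)) })) (lookup (dom e) p))
  (tabulate λ {X} p → let match m d s = lookup (fml e) p in
    match m d (same-fresh (λ q → y∉ (∈-++⁺ʳ (map proj₂ (doms S))
      (∈-concat⁺′ q (∈-map⁺ (AllVars ∘ proj₂ ∘ proj₂) p)))) s))

-- The eigenlabel `u` is sent to `k`. This `k` can be a fresh label of the target, the label chosen
-- by `impL` in a cut, or the label recorded by a covering.
embed-impR : ∀ {φ′ ψ′} → Embed C f σ S R T M → (rhs , w , imp φ ψ) ∈ fmls S → u ∉ clabels S →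
             Reach R (f w) k → M (lhs , k , φ′) → M (rhs , k , ψ′) →
             Same σ φ var φ′ → Same σ ψ var ψ′ →
             Embed C (override f u k) σ
               (ctx ((w , u) ∷ []) [] ((lhs , u , φ) ∷ (rhs , u , ψ) ∷ []) ⊕ S) R T M
embed-impR {f = f} {S = S} {R = R} {u = u} {k = k} e p u∉ r m n s s′ =
  embed-⊕ (embed
    (subst₂ (Reach R) (sym (override-other f k λ { refl → u∉ (∈-clabels {S = S} p) }))
                      (sym (override-same f u k)) r ∷ [])
    []
    (match m (subst (Reach R k) (sym (override-same f u k)) here) s ∷
     match n (subst (λ a → Reach R a k) (sym (override-same f u k)) here) s′ ∷ []))
  (embed-relabel u∉ k e)

embed-exclL : ∀ {φ′ ψ′} → Embed C f σ S R T M → (lhs , w , excl φ ψ) ∈ fmls S → u ∉ clabels S →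
              Reach R k (f w) → M (lhs , k , φ′) → M (rhs , k , ψ′) →
              Same σ φ var φ′ → Same σ ψ var ψ′ →
              Embed C (override f u k) σ
                (ctx ((u , w) ∷ []) [] ((lhs , u , φ) ∷ (rhs , u , ψ) ∷ []) ⊕ S) R T M
embed-exclL {f = f} {S = S} {R = R} {u = u} {k = k} e p u∉ r m n s s′ =
  embed-⊕ (embed
    (subst₂ (Reach R) (sym (override-same f u k))
                      (sym (override-other f k λ { refl → u∉ (∈-clabels {S = S} p) })) r ∷ [])
    []
    (match m (subst (Reach R k) (sym (override-same f u k)) here) s ∷
     match n (subst (λ a → Reach R a k) (sym (override-same f u k)) here) s′ ∷ []))
  (embed-relabel u∉ k e)

-- Serves `fa` as well, since `AllVars` does not distinguish the two quantifiers.
same-eigen : ∀ {φ′} t → y ∉ AllVars (ex x φ) → (∀ t → Same (upd σ x t) φ (upd var z t) φ′) →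
             Same (upd σ y t) (φ [ var y / x ]) var (φ′ [ t / z ])
-- Freshness is known for the quantified formula, so the bodies are wrapped in a quantifier before
-- the environment is updated at `y`.
same-eigen {y} {x} {φ} {σ} t y∉ h with ex h′ ← same-fresh y∉ (Same.ex h) =
  same-inst (var y) h′ (trans (override-same σ y t) (sym (substT-var t)))

∈-cvars : ∀ {s} → (s , w , φ) ∈ fmls S → AllVars φ ⊆ cvars S
∈-cvars {S = S} p q = ∈-++⁺ʳ (map proj₂ (doms S)) (∈-concat⁺′ q (∈-map⁺ (AllVars ∘ proj₂ ∘ proj₂) p))

embed-exL : ∀ {φ′} → Embed C f σ S R T M → (lhs , w , ex x φ) ∈ fmls S → y ∉ cvars S →
            ∀ t → TermOK C R T (f w) t → M (lhs , k , φ′ [ t / z ]) → Reach R k (f w) →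
            (∀ t → Same (upd σ x t) φ (upd var z t) φ′) →
            Embed C f (upd σ y t) (ctx [] ((w , y) ∷ []) ((lhs , w , φ [ var y / x ]) ∷ []) ⊕ S) R T M
embed-exL {C} {f} {σ} {S} {R} {T} {y = y} e p y∉ t ok m d h =
  embed-⊕ (embed [] (subst (TermOK C R T _) (sym (override-same σ y t)) ok ∷ [])
                 (match m d (same-eigen t (y∉ ∘ ∈-cvars {S = S} p) h) ∷ []))
          (embed-upd y∉ t e)

embed-faR : ∀ {φ′} → Embed C f σ S R T M → (rhs , w , fa x φ) ∈ fmls S → u ∉ clabels S → y ∉ cvars S →
            Reach R (f w) k → ∀ t → TermOK C R T k t → M (rhs , k , φ′ [ t / z ]) →
            (∀ t → Same (upd σ x t) φ (upd var z t) φ′) →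
            Embed C (override f u k) (upd σ y t)
              (ctx ((w , u) ∷ []) ((u , y) ∷ []) ((rhs , u , φ [ var y / x ]) ∷ []) ⊕ S) R T M
embed-faR {C} {f} {σ} {S} {R} {T} {u = u} {y = y} {k = k} e p u∉ y∉ r t ok m h =
  embed-⊕ (embed
    (subst₂ (Reach R) (sym (override-other f k λ { refl → u∉ (∈-clabels {S = S} p) }))
                      (sym (override-same f u k)) r ∷ [])
    (subst₂ (TermOK C R T) (sym (override-same f u k)) (sym (override-same σ y t)) ok ∷ [])
    (match m (subst (λ a → Reach R a k) (sym (override-same f u k)) here)
             (same-eigen t (y∉ ∘ ∈-cvars {S = S} p) h) ∷ []))
  (embed-relabel u∉ k (embed-upd y∉ t e))

-- The variables of `ts` under `σ` are those of `ts′`, whose atoms lie at `k` below `f w`. Hence the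
-- image of each variable of `ts` is available at `f w`.
embed-ds : ∀ {ts ts′} → Embed ID f σ S R T M → (∀ {x} → x ∈ VTs ts′ → (k , x) ∈ T) → Reach R k (f w) →
           substTs σ ts ≡ substTs var ts′ →
           Embed ID f σ (ctx [] (map (w ,_) (VTs ts)) [] ⊕ S) R T M
embed-ds {ts = ts} {ts′} e h r eq = embed-⊕ (embed [] (Allₚ.map⁺ (all-substTs⁻ ts
  (subst (All _ ∘ VTs) (sym (trans eq (substTs-var ts′))) (tabulate λ x∈ → _ , h x∈ , r)))) []) e


-- Transfer of rules along embeddings, and weakening.

Premises : ∀ C (S : Context) (R : List RelAtom) (T : List DomAtom) → List Context → List Context →
           (SFormula → Set) → Set
Premises C S R T Es Es′ M = ∀ {E′} → E′ ∈ Es′ →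
  ∃[ E ] E ∈ Es × ∃[ f ] ∃[ σ ]
  Embed C f σ (E ⊕ S) (rels E′ ++ R) (doms E′ ++ T) (λ X → X ∈ fmls E′ ⊎ M X)

record Lifted (C : Calc) (S : Context) (Es : List Context) (S′ : Context) (M : SFormula → Set) : Set where
  constructor lifted
  field
    {principal} : SFormula
    {premises}  : List Context
    mem′ : principal ∈ fmls S′
    rule : Rule C S′ principal premises
    prem : Premises C S (rels S′) (doms S′) Es premises M

-- Side conditions on reachability and terms are carried along the embedding, while eigennames are
-- chosen anew for the target. Leaving `M` open lets the same transfer serve weakening and cut.
lift : ∀ {Φ X Es} → Embed C f σ S R T M → X ∈ fmls S → Rule C S X Es → Match f σ R (_∈ Φ) X →
       Lifted C S Es (ctx R T Φ) M
lift e p botL (match m d bot) = lifted m botL λ ()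
lift e p topR (match m d top) = lifted m topR λ ()
lift e p andL (match m d (and s s′)) = lifted m andL λ where
  (here refl) → _ , here refl , _ , _ ,
    embed-forms (match (inj₁ (here refl)) d s ∷ match (inj₁ (there (here refl))) d s′ ∷ [])
                (embed-mono id id inj₂ e)
lift e p andR (match m d (and s s′)) = lifted m andR λ where
  (here refl) → _ , here refl , _ , _ ,
    embed-forms (match (inj₁ (here refl)) d s ∷ []) (embed-mono id id inj₂ e)
  (there (here refl)) → _ , there (here refl) , _ , _ ,
    embed-forms (match (inj₁ (here refl)) d s′ ∷ []) (embed-mono id id inj₂ e)
lift e p orL (match m d (or s s′)) = lifted m orL λ where
  (here refl) → _ , here refl , _ , _ ,
    embed-forms (match (inj₁ (here refl)) d s ∷ []) (embed-mono id id inj₂ e)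
  (there (here refl)) → _ , there (here refl) , _ , _ ,
    embed-forms (match (inj₁ (here refl)) d s′ ∷ []) (embed-mono id id inj₂ e)
lift e p orR (match m d (or s s′)) = lifted m orR λ where
  (here refl) → _ , here refl , _ , _ ,
    embed-forms (match (inj₁ (here refl)) d s ∷ match (inj₁ (there (here refl))) d s′ ∷ [])
                (embed-mono id id inj₂ e)
lift e p (impL r) (match m d (imp s s′)) = lifted m (impL (reach-trans d (embed-reach e r))) λ where
  (here refl) → _ , here refl , _ , _ ,
    embed-forms (match (inj₁ (here refl)) here s ∷ []) (embed-mono id id inj₂ e)
  (there (here refl)) → _ , there (here refl) , _ , _ ,
    embed-forms (match (inj₁ (here refl)) here s′ ∷ []) (embed-mono id id inj₂ e)
lift {R = R} {T = T} {Φ = Φ} e p (impR u∉) (match m d (imp s s′)) =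
  lifted m (impR (fresh-∉ (clabels (ctx R T Φ)))) λ where
  (here refl) → _ , here refl , _ , _ ,
    embed-impR (embed-mono there id inj₂ e) p u∉
      -- The new edge starts at the place of the matched formula, which lies above the image of the
      -- original label.
      (reach-trans (reach-mono there d) (reach-edge (here refl)))
      (inj₁ (here refl)) (inj₁ (there (here refl))) s s′
lift {R = R} {T = T} {Φ = Φ} e p (exclL u∉) (match m d (excl s s′)) =
  lifted m (exclL (fresh-∉ (clabels (ctx R T Φ)))) λ where
  (here refl) → _ , here refl , _ , _ ,
    embed-exclL (embed-mono there id inj₂ e) p u∉
      (there (here refl) (reach-mono there d))
      (inj₁ (here refl)) (inj₁ (there (here refl))) s s′
lift e p (exclR r) (match m d (excl s s′)) = lifted m (exclR (reach-trans (embed-reach e r) d)) λ where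
  (here refl) → _ , here refl , _ , _ ,
    embed-forms (match (inj₁ (here refl)) here s ∷ []) (embed-mono id id inj₂ e)
  (there (here refl)) → _ , there (here refl) , _ , _ ,
    embed-forms (match (inj₁ (here refl)) here s′ ∷ []) (embed-mono id id inj₂ e)
lift {C = C} {R = R} {T = T} {Φ = Φ} e p (exL y∉) (match m d (ex h)) =
  lifted m (exL (fresh-∉ (cvars (ctx R T Φ)))) λ where
  (here refl) → _ , here refl , _ , _ ,
    embed-exL (embed-mono id there inj₂ e) p y∉ (var _)
      (termOK-reach C d (termOK-var C (here refl))) (inj₁ (here refl)) d h
lift {C = C} {σ = σ} e p (exR t ok) (match m d (ex h)) =
  lifted m (exR (substT σ t) (termOK-reach C d (embed-termOK C e ok))) λ where
  (here refl) → _ , here refl , _ , _ ,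
    embed-forms (match (inj₁ (here refl)) d (same-inst t h (sym (substT-var _)))  ∷ [])
                (embed-mono id id inj₂ e)
lift {C = C} {σ = σ} e p (faL t r ok) (match m d (fa h)) =
  lifted m (faL (substT σ t) (reach-trans d (embed-reach e r)) (embed-termOK C e ok)) λ where
  (here refl) → _ , here refl , _ , _ ,
    embed-forms (match (inj₁ (here refl)) here (same-inst t h (sym (substT-var _))) ∷ [])
                (embed-mono id id inj₂ e)
lift {C = C} {R = R} {T = T} {Φ = Φ} e p (faR u∉ y∉) (match m d (fa h)) =
  lifted m (faR (fresh-∉ (clabels (ctx R T Φ))) (fresh-∉ (cvars (ctx R T Φ)))) λ where
  (here refl) → _ , here refl , _ , _ ,
    embed-faR (embed-mono there there inj₂ e) p u∉ y∉
      (reach-trans (reach-mono there d) (reach-edge (here refl)))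
      (var _) (termOK-var C (here refl)) (inj₁ (here refl)) h
lift {T = T} e p (ds refl) (match {v} {pred _ ts′} m d (pred eq)) = lifted m (ds refl) λ where
  (here refl) → _ , here refl , _ , _ ,
    embed-ds (embed-mono id (∈-++⁺ʳ (map (v ,_) (VTs ts′))) inj₂ e)
      (∈-++⁺ˡ ∘ ∈-map⁺ (v ,_)) d eq

-- On atoms `Same` is equality of substituted arguments, and the target environment is the identity;
-- so the match is literally the substituted atom.
match-pred : ∀ {s w p ts} → Match f σ R M (s , w , pred p ts) →
             ∃[ v ] M (s , v , pred p (substTs σ ts)) × Persist s R v (f w)
match-pred {M = M} (match {v} {pred p ts′} m d (pred eq)) =
  v , subst (λ ts → M (_ , v , pred p ts)) (trans (sym (substTs-var ts′)) (sym eq)) m , d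

-- Induction on the derivation with the embedding generalised: `lift` reproduces the last rule and
-- supplies embeddings for its premises.
weaken : ∀ {Φ} → Deriv C S → Embed C f σ S R T (_∈ Φ) → Deriv C (ctx R T Φ)
weaken (ax p q r) e
  with _ , p′ , d ← match-pred (lookup (fml e) p) | _ , q′ , d′ ← match-pred (lookup (fml e) q) =
  ax p′ q′ (reach-trans d (reach-trans (embed-reach e r) d′))
weaken {Φ = Φ} (step p r h) e with lifted m r′ k ← lift e p r (lookup (fml e) p) = step m r′ λ {E′} i →
  let _ , j , _ , _ , e′ = k i in
  weaken (h j) (embed-mono id id [ ∈-++⁺ˡ , ∈-++⁺ʳ (fmls E′) ]′ e′)

weaken-⊆ : ∀ {Φ Φ′} → Deriv C (ctx R T Φ) → R ⊆ R′ → T ⊆ T′ → Φ ⊆ Φ′ → Deriv C (ctx R′ T′ Φ′)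
weaken-⊆ d r t p = weaken d (embed-id r t p)

-- Cut elimination in the cumulative calculus.

With : SFormula → List SFormula → SFormula → Set
With X Φ Y = Y ≡ X ⊎ Y ∈ Φ

with-++ : ∀ {X Φ} Ψ → ∀ {Y} → Y ∈ Ψ ⊎ With X Φ Y → With X (Ψ ++ Φ) Y
with-++ Ψ (inj₁ p)        = inj₂ (∈-++⁺ˡ p)
with-++ Ψ (inj₂ (inj₁ e)) = inj₁ e
with-++ Ψ (inj₂ (inj₂ p)) = inj₂ (∈-++⁺ʳ Ψ p)

with-⊆ : ∀ {X Φ Φ′} → Φ ⊆ Φ′ → ∀ {Y} → With X Φ Y → With X Φ′ Y
with-⊆ h (inj₁ e) = inj₁ e
with-⊆ h (inj₂ p) = inj₂ (h p)

-- For cuts against axioms: a copy of the cut formula among the side formulae, at a suitable label,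
-- takes over all its uses.
match-replace : ∀ {s χ Φ} → (s , v , χ) ∈ Φ → Persist s R v u → ∀ {X} →
                Match f σ R (With (s , u , χ) Φ) X → Match f σ R (_∈ Φ) X
match-replace m d (match (inj₂ p) d′ s) = match p d′ s
match-replace {s = lhs} m d {_ , _ , _} (match (inj₁ refl) d′ s) = match m (reach-trans d d′) s
match-replace {s = rhs} m d {_ , _ , _} (match (inj₁ refl) d′ s) = match m (reach-trans d′ d) s

embed-replace : ∀ {s χ Φ} → (s , v , χ) ∈ Φ → Persist s R v u →
                Embed C f σ S R T (With (s , u , χ) Φ) → Embed C f σ S R T (_∈ Φ)
embed-replace m d (embed r o ms) = embed r o (All.map (match-replace m d) ms)

-- One label `u` suffices, because matches let right occurrences lie below it and left occurrences
-- above it. Several occurrences may match the same cut formula, so contraction causes no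
-- difficulty.
Cut : Calc → Formula → Context → Context → Set
Cut C χ S₁ S₂ = ∀ {f₁ f₂ σ₁ σ₂ u R T Φ} →
  Embed C f₁ σ₁ S₁ R T (With (rhs , u , χ) Φ) →
  Embed C f₂ σ₂ S₂ R T (With (lhs , u , χ) Φ) →
  Deriv C (ctx R T Φ)

CutFor : Calc → Formula → Set
CutFor C χ = ∀ {S₁ S₂} → Deriv C S₁ → Deriv C S₂ → Cut C χ S₁ S₂

cut-on : ∀ {Φ} → CutFor C χ → Deriv C (ctx R T ((rhs , u , χ) ∷ Φ)) →
         Deriv C (ctx R T ((lhs , u , χ) ∷ Φ)) → Deriv C (ctx R T Φ)
cut-on {C} {χ} {R} {T} {u} {Φ} c d₁ d₂ = c d₁ d₂ (embed-id id id uncons) (embed-id id id uncons)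
  where
  uncons : ∀ {X Y : SFormula} → Y ∈ X ∷ Φ → With X Φ Y
  uncons (here e)  = inj₁ e
  uncons (there p) = inj₂ p

-- The inner induction hypothesis: a premise of one derivation has been cut against the other
-- derivation. The larger `Φ′` leaves room for the components that the premise adds.
CutPremises : Calc → SFormula → Context → List RelAtom → List DomAtom → List SFormula → List Context → Set
CutPremises C X S R T Φ Es = ∀ {E} → E ∈ Es → ∀ {f σ Φ′} → Φ ⊆ Φ′ →
  Embed C f σ (E ⊕ S) R T (With X Φ′) → Deriv C (ctx R T Φ′)

-- The principal case. Cumulative premises still contain the cut formula, which `h₁` and `h₂` remove
-- first; what remains are cuts on components, of smaller size.
reduce : ∀ {f₁ f₂ σ₁ σ₂ w₁ w₂ χ₁ χ₂ Φ Es₁ Es₂} →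
  (∀ {φ} → size φ < size χ → CutFor C φ) →
  Embed C f₁ σ₁ S₁ R T (With (rhs , u , χ) Φ) → (rhs , w₁ , χ₁) ∈ fmls S₁ →
  Rule C S₁ (rhs , w₁ , χ₁) Es₁ → Reach R (f₁ w₁) u → Same σ₁ χ₁ var χ →
  CutPremises C (rhs , u , χ) S₁ R T Φ Es₁ →
  Embed C f₂ σ₂ S₂ R T (With (lhs , u , χ) Φ) → (lhs , w₂ , χ₂) ∈ fmls S₂ →
  Rule C S₂ (lhs , w₂ , χ₂) Es₂ → Reach R u (f₂ w₂) → Same σ₂ χ₂ var χ →
  CutPremises C (lhs , u , χ) S₂ R T Φ Es₂ →
  Deriv C (ctx R T Φ)
-- No left rule has `top` as principal formula; no right rule has `bot` or an atom, so these need no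
-- clause.
reduce ih e₁ p₁ topR d₁ top h₁ e₂ p₂ () d₂ top h₂
reduce {χ = and φ ψ} ih e₁ p₁ andR d₁ (and s₁ t₁) h₁ e₂ p₂ andL d₂ (and s₂ t₂) h₂ =
  cut-on (ih (s≤s (m≤n+m _ _)))
    (h₁ (there (here refl)) there
      (embed-forms (match (inj₂ (here refl)) d₁ t₁ ∷ []) (embed-mono id id (with-⊆ there) e₁)))
    (cut-on (ih (s≤s (m≤m+n _ _)))
      (weaken-⊆
        (h₁ (here refl) there
          (embed-forms (match (inj₂ (here refl)) d₁ s₁ ∷ []) (embed-mono id id (with-⊆ there) e₁)))
        id id insert₂)
      (h₂ (here refl) skip₂
        (embed-forms (match (inj₂ (here refl)) d₂ s₂ ∷ match (inj₂ (there (here refl))) d₂ t₂ ∷ [])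
          (embed-mono id id (with-⊆ skip₂) e₂))))
reduce {χ = or φ ψ} ih e₁ p₁ orR d₁ (or s₁ t₁) h₁ e₂ p₂ orL d₂ (or s₂ t₂) h₂ =
  cut-on (ih (s≤s (m≤n+m _ _)))
    (cut-on (ih (s≤s (m≤m+n _ _)))
      (h₁ (here refl) skip₂
        (embed-forms (match (inj₂ (here refl)) d₁ s₁ ∷ match (inj₂ (there (here refl))) d₁ t₁ ∷ [])
          (embed-mono id id (with-⊆ skip₂) e₁)))
      (weaken-⊆
        (h₂ (here refl) there
          (embed-forms (match (inj₂ (here refl)) d₂ s₂ ∷ []) (embed-mono id id (with-⊆ there) e₂)))
        id id insert₂))
    (h₂ (there (here refl)) there
      (embed-forms (match (inj₂ (here refl)) d₂ t₂ ∷ []) (embed-mono id id (with-⊆ there) e₂)))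
reduce {χ = imp φ ψ} ih e₁ p₁ (impR u∉) d₁ (imp s₁ t₁) h₁ e₂ p₂ (impL r) d₂ (imp s₂ t₂) h₂ =
  cut-on (ih (s≤s (m≤n+m _ _)))
    (cut-on (ih (s≤s (m≤m+n _ _)))
      (weaken-⊆
        (h₂ (here refl) there
          (embed-forms (match (inj₂ (here refl)) here s₂ ∷ []) (embed-mono id id (with-⊆ there) e₂)))
        id id insert₂)
      (h₁ (here refl) skip₂
        -- The eigenlabel becomes the label at which `impL` acts, reached from the right occurrence
        -- by way of the cut label `u`.
        (embed-impR (embed-mono id id (with-⊆ skip₂) e₁) p₁ u∉
          (reach-trans d₁ (reach-trans d₂ (embed-reach e₂ r)))
          (inj₂ (here refl)) (inj₂ (there (here refl))) s₁ t₁)))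
    (h₂ (there (here refl)) there
      (embed-forms (match (inj₂ (here refl)) here t₂ ∷ []) (embed-mono id id (with-⊆ there) e₂)))
reduce {χ = excl φ ψ} ih e₁ p₁ (exclR r) d₁ (excl s₁ t₁) h₁ e₂ p₂ (exclL u∉) d₂ (excl s₂ t₂) h₂ =
  cut-on (ih (s≤s (m≤n+m _ _)))
    (cut-on (ih (s≤s (m≤m+n _ _)))
      (weaken-⊆
        (h₁ (here refl) there
          (embed-forms (match (inj₂ (here refl)) here s₁ ∷ []) (embed-mono id id (with-⊆ there) e₁)))
        id id insert₂)
      (h₂ (here refl) skip₂
        -- Dually, the eigenlabel becomes the label chosen by `exclR`, from which the left
        -- occurrence is reached.
        (embed-exclL (embed-mono id id (with-⊆ skip₂) e₂) p₂ u∉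
          (reach-trans (embed-reach e₁ r) (reach-trans d₁ d₂))
          (inj₂ (here refl)) (inj₂ (there (here refl))) s₂ t₂)))
    (h₁ (there (here refl)) there
      (embed-forms (match (inj₂ (here refl)) here t₁ ∷ []) (embed-mono id id (with-⊆ there) e₁)))
reduce {χ = ex x φ} {C = C} {σ₁ = σ₁} ih e₁ p₁ (exR t ok) d₁ (ex s₁) h₁ e₂ p₂ (exL y∉) d₂ (ex s₂) h₂ =
  cut-on (ih (s≤s (≤-reflexive (size-subst φ))))
    (h₁ (here refl) there
      (embed-forms (match (inj₂ (here refl)) d₁ (same-inst t s₁ (sym (substT-var _))) ∷ [])
        (embed-mono id id (with-⊆ there) e₁)))
    (h₂ (here refl) there
      -- The eigenvariable becomes the witness of `exR`, whose availability persists upwards through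
      -- the cut label.
      (embed-exL (embed-mono id id (with-⊆ there) e₂) p₂ y∉ (substT σ₁ t)
        (termOK-reach {t = substT σ₁ t} C (reach-trans d₁ d₂) (embed-termOK {t = t} C e₁ ok))
        (inj₂ (here refl)) d₂ s₂))
reduce {χ = fa x φ} {C = C} {σ₂ = σ₂} ih e₁ p₁ (faR u∉ y∉) d₁ (fa s₁) h₁ e₂ p₂ (faL t r ok) d₂ (fa s₂) h₂ =
  cut-on (ih (s≤s (≤-reflexive (size-subst φ))))
    (h₁ (here refl) there
      -- Eigenlabel and eigenvariable become the label and the term used by `faL`.
      (embed-faR (embed-mono id id (with-⊆ there) e₁) p₁ u∉ y∉
        (reach-trans d₁ (reach-trans d₂ (embed-reach e₂ r)))
        (substT σ₂ t) (embed-termOK {t = t} C e₂ ok) (inj₂ (here refl)) s₁))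
    (h₂ (here refl) there
      (embed-forms (match (inj₂ (here refl)) here (same-inst t s₂ (sym (substT-var _))) ∷ [])
        (embed-mono id id (with-⊆ there) e₂)))

-- The last rule acts on a side formula: it is repeated below the cut, and the cut moves to its
-- premises.
permute : ∀ {X Y Es Φ} → Embed C f σ S R T (With Y Φ) → X ∈ fmls S → Rule C S X Es →
          Match f σ R (_∈ Φ) X →
          (∀ {E} → E ∈ Es → ∀ E′ {f σ} →
           Embed C f σ (E ⊕ S) (rels E′ ++ R) (doms E′ ++ T) (With Y (fmls E′ ++ Φ)) →
           Deriv C (E′ ⊕ ctx R T Φ)) →
          Deriv C (ctx R T Φ)
permute e p r m h with lifted m′ r′ k ← lift e p r m = step m′ r′ λ {E} i →
  let _ , j , _ , _ , e′ = k i in h j E (embed-mono id id (with-++ (fmls E)) e′)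

embed-⊕-target : ∀ {X Φ} E → Embed C f σ S R T (With X Φ) →
                 Embed C f σ S (rels E ++ R) (doms E ++ T) (With X (fmls E ++ Φ))
embed-⊕-target E = embed-mono (∈-++⁺ʳ (rels E)) (∈-++⁺ʳ (doms E)) (with-⊆ (∈-++⁺ʳ (fmls E)))

cut-steps : ∀ {X₁ X₂ Es₁ Es₂} → (∀ {φ} → size φ < size χ → CutFor C φ) →
  X₁ ∈ fmls S₁ → Rule C S₁ X₁ Es₁ → X₂ ∈ fmls S₂ → Rule C S₂ X₂ Es₂ →
  (∀ {E} → E ∈ Es₁ → Cut C χ (E ⊕ S₁) S₂) → (∀ {E} → E ∈ Es₂ → Cut C χ S₁ (E ⊕ S₂)) →
  Cut C χ S₁ S₂
cut-steps ih p₁ r₁ p₂ r₂ h₁ h₂ e₁ e₂ with lookup (fml e₁) p₁ | lookup (fml e₂) p₂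
... | match (inj₂ m) l s | _ = permute e₁ p₁ r₁ (match m l s) λ j E e → h₁ j e (embed-⊕-target E e₂)
... | _ | match (inj₂ m) l s = permute e₂ p₂ r₂ (match m l s) λ j E e → h₂ j (embed-⊕-target E e₁) e
... | match (inj₁ refl) l₁ s₁ | match (inj₁ refl) l₂ s₂ =
  reduce ih e₁ p₁ r₁ l₁ s₁ (λ j i e → h₁ j e (embed-mono id id (with-⊆ i) e₂))
            e₂ p₂ r₂ l₂ s₂ (λ j i e → h₂ j (embed-mono id id (with-⊆ i) e₁) e)

cut-step : (∀ {φ} → size φ < size χ → CutFor C φ) → CutFor C χ
cut-step ih (ax p q r) d₂ e₁ e₂
  with match-pred (lookup (fml e₁) p) | match-pred (lookup (fml e₁) q)
... | _ , inj₂ p′ , l | _ , inj₂ q′ , l′ = ax p′ q′ (reach-trans l (reach-trans (embed-reach e₁ r) l′))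
-- The axiom provides a left copy of the atomic cut formula below `u`, which replaces the cut
-- formula in `d₂`.
... | _ , inj₂ p′ , l | _ , inj₁ refl , l′ =
  weaken d₂ (embed-replace p′ (reach-trans l (reach-trans (embed-reach e₁ r) l′)) e₂)
cut-step ih d₁@(step _ _ _) (ax p q r) e₁ e₂
  with match-pred (lookup (fml e₂) p) | match-pred (lookup (fml e₂) q)
... | _ , inj₂ p′ , l | _ , inj₂ q′ , l′ = ax p′ q′ (reach-trans l (reach-trans (embed-reach e₂ r) l′))
... | _ , inj₁ refl , l | _ , inj₂ q′ , l′ =
  weaken d₁ (embed-replace q′ (reach-trans l (reach-trans (embed-reach e₂ r) l′)) e₁)
cut-step ih d₁@(step p₁ r₁ h₁) d₂@(step p₂ r₂ h₂) =
  -- Each call keeps one derivation and passes to a premise of the other.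
  cut-steps ih p₁ r₁ p₂ r₂ (λ j → cut-step ih (h₁ j) d₂) (λ j → cut-step ih d₁ (h₂ j))

cut-for : ∀ χ → CutFor C χ
cut-for {C} χ = <-rec (λ n → ∀ χ → size χ ≡ n → CutFor C χ)
  (λ { _ ih χ refl → cut-step λ lt → ih lt _ refl }) (size χ) χ refl

-- From LBIQ to the cumulative calculus.

tag : Side → LFormula → SFormula
tag s l = s , l

-- Abstract so that Γ and Δ can be inferred from tagged Γ Δ.
abstract
  tagged : List LFormula → List LFormula → List SFormula
  tagged Γ Δ = map (tag lhs) Γ ++ map (tag rhs) Δ

  ∈-tagged-left : ∀ {l} → l ∈ Γ → (lhs , l) ∈ tagged Γ Δ
  ∈-tagged-left = ∈-++⁺ˡ ∘ ∈-map⁺ (tag lhs)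

  ∈-tagged-right : ∀ {l} → l ∈ Δ → (rhs , l) ∈ tagged Γ Δ
  ∈-tagged-right {Γ = Γ} = ∈-++⁺ʳ (map (tag lhs) Γ) ∘ ∈-map⁺ (tag rhs)

  all-tagged : ∀ {P : SFormula → Set} → All (P ∘ tag lhs) Γ → All (P ∘ tag rhs) Δ → All P (tagged Γ Δ)
  all-tagged p q = Allₚ.++⁺ (Allₚ.map⁺ p) (Allₚ.map⁺ q)

context : Sequent → Context
context (mkSeq R T Γ Δ) = ctx R T (tagged Γ Δ)

abstract
  clabels-context : ∀ R T Γ Δ → clabels (context (mkSeq R T Γ Δ)) ≡ labels (mkSeq R T Γ Δ)
  clabels-context R T Γ Δ = cong (λ ls → verts R ++ map proj₁ T ++ ls)
    (trans (map-++ _ (map (tag lhs) Γ) (map (tag rhs) Δ)) (cong₂ _++_ (sym (map-∘ Γ)) (sym (map-∘ Δ))))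

  cvars-context : ∀ R T Γ Δ → cvars (context (mkSeq R T Γ Δ)) ≡ vars (mkSeq R T Γ Δ)
  cvars-context R T Γ Δ = cong (map proj₂ T ++_)
    (trans (concatMap-++ sfvars (map (tag lhs) Γ) (map (tag rhs) Δ))
      (trans (cong₂ _++_ (concatMap-map sfvars (tag lhs) Γ) (concatMap-map sfvars (tag rhs) Δ))
        (sym (concatMap-++ (AllVars ∘ proj₂) Γ Δ))))
    where
    sfvars : SFormula → List Var
    sfvars = AllVars ∘ proj₂ ∘ proj₂

-- A premise in LBIQ consists of new formulae and formulae of the conclusion, so weakening adds the
-- principal formula that the cumulative rule retains.
premise : ∀ E → Deriv C (ctx (rels E ++ R) (doms E ++ T) (tagged Γ′ Δ′)) →
          All (λ l → (lhs , l) ∈ fmls E ⊎ l ∈ Γ) Γ′ → All (λ l → (rhs , l) ∈ fmls E ⊎ l ∈ Δ) Δ′ →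
          Deriv C (E ⊕ context (mkSeq R T Γ Δ))
premise {Γ = Γ} {Δ = Δ} E d p q = weaken-⊆ d id id (lookup (all-tagged {P = _∈ _}
  (All.map [ ∈-++⁺ˡ , ∈-++⁺ʳ (fmls E) ∘ ∈-tagged-left ]′ p)
  (All.map [ ∈-++⁺ˡ , ∈-++⁺ʳ (fmls E) ∘ ∈-tagged-right ]′ q)))

old : ∀ {P : LFormula → Set} → Γ ⊆ Γ′ → All (λ l → P l ⊎ l ∈ Γ′) Γ
old h = tabulate (inj₂ ∘ h)

fromProv : ∀ {S} → Prov C S → Deriv C (context S)
fromProv (exch d r t g h) = weaken-⊆ (fromProv d) (∈-resp-↭ r) (∈-resp-↭ t)
  (lookup (all-tagged {P = _∈ _} (tabulate (∈-tagged-left ∘ ∈-resp-↭ g))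
                      (tabulate (∈-tagged-right ∘ ∈-resp-↭ h))))
-- The renaming itself is the relabelling of an embedding.
fromProv {C} (rename {mkSeq R T Γ Δ} f d) = weaken (fromProv d) (embed
  (tabulate (reach-edge ∘ ∈-map⁺ _))
  (tabulate (termOK-var C ∘ ∈-map⁺ _))
  (all-tagged
    (tabulate λ p → match (∈-tagged-left (∈-map⁺ _ p)) here same-refl)
    (tabulate λ p → match (∈-tagged-right (∈-map⁺ _ p)) here same-refl)))
fromProv (ax r) =
  ax (∈-tagged-left (here refl)) (∈-tagged-right (here refl)) r
fromProv botL = step (∈-tagged-left (here refl)) botL λ ()
fromProv (topR {Γ = Γ}) = step (∈-tagged-right (here refl)) topR λ ()
fromProv (andL d) = step (∈-tagged-left (here refl)) andL λ {
    {E} (here refl) → premise E (fromProv d)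
      (inj₁ (here refl) ∷ inj₁ (there (here refl)) ∷ old there) (old id) }
fromProv (andR d d′) = step (∈-tagged-right (here refl)) andR λ {
    {E} (here refl)         → premise E (fromProv d) (old id) (inj₁ (here refl) ∷ old there)
  ; {E} (there (here refl)) → premise E (fromProv d′) (old id) (inj₁ (here refl) ∷ old there) }
fromProv (orL d d′) = step (∈-tagged-left (here refl)) orL λ {
    {E} (here refl)         → premise E (fromProv d) (inj₁ (here refl) ∷ old there) (old id)
  ; {E} (there (here refl)) → premise E (fromProv d′) (inj₁ (here refl) ∷ old there) (old id) }
fromProv (orR d) = step (∈-tagged-right (here refl)) orR λ {
    {E} (here refl) → premise E (fromProv d) (old id)
      (inj₁ (here refl) ∷ inj₁ (there (here refl)) ∷ old there) }
fromProv (impL r d d′) = step (∈-tagged-left (here refl)) (impL r) λ {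
    {E} (here refl)         → premise E (fromProv d) (old id) (inj₁ (here refl) ∷ old id)
  ; {E} (there (here refl)) → premise E (fromProv d′) (inj₁ (here refl) ∷ old id) (old id) }
fromProv (impR {R} {T} {Γ} {Δ} u∉ d) = step (∈-tagged-right (here refl))
  (impR (u∉ ∘ subst (_ ∈_) (clabels-context R T Γ _))) λ {
    {E} (here refl) → premise E (fromProv d) (inj₁ (here refl) ∷ old id)
      (inj₁ (there (here refl)) ∷ old there) }
fromProv (exclL {R} {T} {Γ} {Δ} u∉ d) = step (∈-tagged-left (here refl))
  (exclL (u∉ ∘ subst (_ ∈_) (clabels-context R T _ Δ))) λ {
    {E} (here refl) → premise E (fromProv d) (inj₁ (here refl) ∷ old there)
      (inj₁ (there (here refl)) ∷ old id) }
fromProv (exclR r d d′) = step (∈-tagged-right (here refl)) (exclR r) λ {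
    {E} (here refl) → premise E (fromProv d) (old id)
      (inj₂ (here refl) ∷ inj₁ (here refl) ∷ old there)
  ; {E} (there (here refl)) → premise E (fromProv d′) (inj₁ (here refl) ∷ old id) (old id) }
fromProv (exL {R} {T} {Γ} {Δ} y∉ d) = step (∈-tagged-left (here refl))
  (exL (y∉ ∘ subst (_ ∈_) (cvars-context R T _ Δ))) λ {
    {E} (here refl) → premise E (fromProv d) (inj₁ (here refl) ∷ old there) (old id) }
fromProv (exR t ok d) = step (∈-tagged-right (here refl)) (exR t ok) λ {
    {E} (here refl) → premise E (fromProv d) (old id)
      (inj₂ (here refl) ∷ inj₁ (here refl) ∷ old there) }
fromProv (faL t r ok d) = step (∈-tagged-left (here refl)) (faL t r ok) λ {
    {E} (here refl) → premise E (fromProv d)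
      (inj₂ (here refl) ∷ inj₁ (here refl) ∷ old there) (old id) }
fromProv (faR {R} {T} {Γ} {Δ} u∉ y∉ d) = step (∈-tagged-right (here refl))
  (faR (u∉ ∘ subst (_ ∈_) (clabels-context R T Γ _)) (y∉ ∘ subst (_ ∈_) (cvars-context R T Γ _))) λ {
    {E} (here refl) → premise E (fromProv d) (old id) (inj₁ (here refl) ∷ old there) }
fromProv (ds refl d) = step (∈-tagged-left (here refl)) (ds refl) λ {
    {E} (here refl) → premise E (fromProv d) (old id) (old id) }

-- From the cumulative calculus back to LBIQ.

open Sequent

-- X is covered by S if it belongs to S or enough of its components, as
-- introduced by the rules that discard their principal formula, are covered.
-- Embedding into the covered formulae yields contraction and inversion at once.
data Cov (C : Calc) (S : Sequent) : SFormula → Set where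
  inL   : ∀ {l} → l ∈ ant S → Cov C S (lhs , l)
  inR   : ∀ {l} → l ∈ suc′ S → Cov C S (rhs , l)
  andL  : Cov C S (lhs , w , φ) → Cov C S (lhs , w , ψ) → Cov C S (lhs , w , and φ ψ)
  andR₁ : Cov C S (rhs , w , φ) → Cov C S (rhs , w , and φ ψ)
  andR₂ : Cov C S (rhs , w , ψ) → Cov C S (rhs , w , and φ ψ)
  orL₁  : Cov C S (lhs , w , φ) → Cov C S (lhs , w , or φ ψ)
  orL₂  : Cov C S (lhs , w , ψ) → Cov C S (lhs , w , or φ ψ)
  orR   : Cov C S (rhs , w , φ) → Cov C S (rhs , w , ψ) → Cov C S (rhs , w , or φ ψ)
  impR  : Reach (rel S) w u → Cov C S (lhs , u , φ) → Cov C S (rhs , u , ψ) → Cov C S (rhs , w , imp φ ψ)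
  exclL : Reach (rel S) u w → Cov C S (lhs , u , φ) → Cov C S (rhs , u , ψ) → Cov C S (lhs , w , excl φ ψ)
  exL   : ∀ t → TermOK C (rel S) (dom S) w t → Cov C S (lhs , w , φ [ t / x ]) → Cov C S (lhs , w , ex x φ)
  faR   : ∀ t → Reach (rel S) w u → TermOK C (rel S) (dom S) u t → Cov C S (rhs , u , φ [ t / x ]) →
          Cov C S (rhs , w , fa x φ)

module _ {C : Calc} {S S′ : Sequent} (r : rel S ⊆ rel S′) (d : dom S ⊆ dom S′)
         (a : ∀ {l} → l ∈ ant S → Cov C S′ (lhs , l)) (s : ∀ {l} → l ∈ suc′ S → Cov C S′ (rhs , l)) where
  -- A covering is a tree whose leaves are formulae of the sequent; each leaf is replaced by a
  -- covering in `S′`.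
  cov-bind : ∀ {X} → Cov C S X → Cov C S′ X
  cov-bind (inL p)         = a p
  cov-bind (inR p)         = s p
  cov-bind (andL c c′)     = andL (cov-bind c) (cov-bind c′)
  cov-bind (andR₁ c)       = andR₁ (cov-bind c)
  cov-bind (andR₂ c)       = andR₂ (cov-bind c)
  cov-bind (orL₁ c)        = orL₁ (cov-bind c)
  cov-bind (orL₂ c)        = orL₂ (cov-bind c)
  cov-bind (orR c c′)      = orR (cov-bind c) (cov-bind c′)
  cov-bind (impR q c c′)   = impR (reach-mono r q) (cov-bind c) (cov-bind c′)
  cov-bind (exclL q c c′)  = exclL (reach-mono r q) (cov-bind c) (cov-bind c′)
  cov-bind (exL t ok c)    = exL t (termOK-mono {t = t} C r d ok) (cov-bind c)
  cov-bind (faR t q ok c)  = faR t (reach-mono r q) (termOK-mono {t = t} C r d ok) (cov-bind c)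

cov-⊆ : Γ ⊆ Γ′ → Δ ⊆ Δ′ → ∀ {X} → Cov C (mkSeq R T Γ Δ) X → Cov C (mkSeq R T Γ′ Δ′) X
cov-⊆ g h = cov-bind id id (inL ∘ g) (inR ∘ h)

-- For passing from a conclusion to a premise in which the principal formula `l` has been replaced
-- by components that cover it.
cov-left : ∀ {l} → R ⊆ R′ → T ⊆ T′ → Γ ⊆ Γ′ → Δ ⊆ Δ′ → Cov C (mkSeq R′ T′ Γ′ Δ′) (lhs , l) →
           ∀ {X} → Cov C (mkSeq R T (l ∷ Γ) Δ) X → Cov C (mkSeq R′ T′ Γ′ Δ′) X
cov-left r t g h c = cov-bind r t (λ { (here refl) → c ; (there p) → inL (g p) }) (inR ∘ h)

cov-right : ∀ {l} → R ⊆ R′ → T ⊆ T′ → Γ ⊆ Γ′ → Δ ⊆ Δ′ → Cov C (mkSeq R′ T′ Γ′ Δ′) (rhs , l) →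
            ∀ {X} → Cov C (mkSeq R T Γ (l ∷ Δ)) X → Cov C (mkSeq R′ T′ Γ′ Δ′) X
cov-right r t g h c = cov-bind r t (inL ∘ g) (λ { (here refl) → c ; (there p) → inR (h p) })

select : ∀ {x : A} {xs} → x ∈ xs → ∃[ ys ] x ∷ ys ↭ xs
select p with ys , zs , refl ← ∈-∃++ p = ys ++ zs , ↭-sym (shift _ ys zs)

-- Exchange brings `l` to the front, where the rules expect it; the continuation also receives the
-- transport of coverings to the reordered sequent.
on-left : ∀ {l} → l ∈ Γ →
  (∀ {Γ′} → (∀ {X} → Cov C (mkSeq R T Γ Δ) X → Cov C (mkSeq R T (l ∷ Γ′) Δ) X) →
   Prov C (mkSeq R T (l ∷ Γ′) Δ)) →
  Prov C (mkSeq R T Γ Δ)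
on-left p k with _ , q ← select p =
  exch (k (cov-⊆ (∈-resp-↭ (↭-sym q)) id)) ↭-refl ↭-refl q ↭-refl

on-right : ∀ {l} → l ∈ Δ →
  (∀ {Δ′} → (∀ {X} → Cov C (mkSeq R T Γ Δ) X → Cov C (mkSeq R T Γ (l ∷ Δ′)) X) →
   Prov C (mkSeq R T Γ (l ∷ Δ′))) →
  Prov C (mkSeq R T Γ Δ)
on-right p k with _ , q ← select p =
  exch (k (cov-⊆ id (∈-resp-↭ (↭-sym q)))) ↭-refl ↭-refl ↭-refl q

-- If the principal formula is present, the LBIQ rule is applied and its components cover what it
-- discards. If it is covered through components, no rule is applied and a premise with covered
-- additions is used directly.
toProv : Deriv C S → Embed C f σ S R T (Cov C (mkSeq R T Γ Δ)) → Prov C (mkSeq R T Γ Δ)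
toProv (ax p q r) e
  with match-pred (lookup (fml e) p) | match-pred (lookup (fml e) q)
... | _ , inL p′ , l | _ , inR q′ , l′ with _ , g ← select p′ | _ , h ← select q′ =
  exch (ax (reach-trans l (reach-trans (embed-reach e r) l′))) ↭-refl ↭-refl g h
toProv (step p r h) e with r | lookup (fml e) p
... | botL | match (inL m) d bot = on-left m λ _ → botL
... | topR | match (inR m) d top = on-right m λ _ → topR
... | andL | match (inL m) d (and s s′) = on-left m λ c → andL (toProv (h (here refl))
  (embed-forms (match (inL (here refl)) d s ∷ match (inL (there (here refl))) d s′ ∷ [])
    (embed-mono id id (cov-left id id skip₂ id (andL (inL (here refl)) (inL (there (here refl)))) ∘ c) e)))
... | andL | match (andL c c′) d (and s s′) = toProv (h (here refl))
  (embed-forms (match c d s ∷ match c′ d s′ ∷ []) e)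
... | andR | match (inR m) d (and s s′) = on-right m λ c → andR
  (toProv (h (here refl)) (embed-forms (match (inR (here refl)) d s ∷ [])
    (embed-mono id id (cov-right id id id there (andR₁ (inR (here refl))) ∘ c) e)))
  (toProv (h (there (here refl))) (embed-forms (match (inR (here refl)) d s′ ∷ [])
    (embed-mono id id (cov-right id id id there (andR₂ (inR (here refl))) ∘ c) e)))
-- Only the premise for the recorded conjunct is needed; the other branch is dropped.
... | andR | match (andR₁ c) d (and s s′) = toProv (h (here refl)) (embed-forms (match c d s ∷ []) e)
... | andR | match (andR₂ c) d (and s s′) = toProv (h (there (here refl))) (embed-forms (match c d s′ ∷ []) e)
... | orL | match (inL m) d (or s s′) = on-left m λ c → orL
  (toProv (h (here refl)) (embed-forms (match (inL (here refl)) d s ∷ [])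
    (embed-mono id id (cov-left id id there id (orL₁ (inL (here refl))) ∘ c) e)))
  (toProv (h (there (here refl))) (embed-forms (match (inL (here refl)) d s′ ∷ [])
    (embed-mono id id (cov-left id id there id (orL₂ (inL (here refl))) ∘ c) e)))
... | orL | match (orL₁ c) d (or s s′) = toProv (h (here refl)) (embed-forms (match c d s ∷ []) e)
... | orL | match (orL₂ c) d (or s s′) = toProv (h (there (here refl))) (embed-forms (match c d s′ ∷ []) e)
... | orR | match (inR m) d (or s s′) = on-right m λ c → orR (toProv (h (here refl))
  (embed-forms (match (inR (here refl)) d s ∷ match (inR (there (here refl))) d s′ ∷ [])
    (embed-mono id id (cov-right id id id skip₂ (orR (inR (here refl)) (inR (there (here refl)))) ∘ c) e)))
... | orR | match (orR c c′) d (or s s′) = toProv (h (here refl))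
  (embed-forms (match c d s ∷ match c′ d s′ ∷ []) e)
-- LBIQ keeps this principal formula, so being covered can only mean being present.
... | impL q | match (inL m) d (imp s s′) = on-left m λ c → impL (reach-trans d (embed-reach e q))
  (toProv (h (here refl)) (embed-forms (match (inR (here refl)) here s ∷ [])
    (embed-mono id id (cov-⊆ id there ∘ c) e)))
  (toProv (h (there (here refl))) (embed-forms (match (inL (here refl)) here s′ ∷ [])
    (embed-mono id id (cov-⊆ there id ∘ c) e)))
... | impR u∉ | match (inR m) d (imp s s′) = on-right m λ c → impR (fresh-∉ _) (toProv (h (here refl))
  (embed-impR (embed-mono there id (cov-right there id there there
      (impR (reach-edge (here refl)) (inL (here refl)) (inR (here refl))) ∘ c) e) p u∉
    (reach-trans (reach-mono there d) (reach-edge (here refl)))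
    (inL (here refl)) (inR (here refl)) s s′))
-- The eigenlabel is sent to the label at which the components were recorded.
... | impR u∉ | match (impR q c c′) d (imp s s′) = toProv (h (here refl))
  (embed-impR e p u∉ (reach-trans d q) c c′ s s′)
... | exclL u∉ | match (inL m) d (excl s s′) = on-left m λ c → exclL (fresh-∉ _) (toProv (h (here refl))
  (embed-exclL (embed-mono there id (cov-left there id there there
      (exclL (reach-edge (here refl)) (inL (here refl)) (inR (here refl))) ∘ c) e) p u∉
    (there (here refl) (reach-mono there d))
    (inL (here refl)) (inR (here refl)) s s′))
... | exclL u∉ | match (exclL q c c′) d (excl s s′) = toProv (h (here refl))
  (embed-exclL e p u∉ (reach-trans q d) c c′ s s′)
... | exclR q | match (inR m) d (excl s s′) = on-right m λ c → exclR (reach-trans (embed-reach e q) d)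
  (toProv (h (here refl)) (embed-forms (match (inR (there (here refl))) here s ∷ [])
    (embed-mono id id (cov-⊆ id insert₂ ∘ c) e)))
  (toProv (h (there (here refl))) (embed-forms (match (inL (here refl)) here s′ ∷ [])
    (embed-mono id id (cov-⊆ there id ∘ c) e)))
... | exL y∉ | match (inL m) d (ex s) = on-left m λ c → exL (fresh-∉ _) (toProv (h (here refl))
  (embed-exL (embed-mono id there (cov-left id there there id
      (exL (var _) (termOK-var _ (here refl)) (inL (here refl))) ∘ c) e) p y∉
    (var _) (termOK-reach {t = var _} _ d (termOK-var _ (here refl))) (inL (here refl)) d s))
... | exL y∉ | match (exL t ok c) d (ex s) = toProv (h (here refl))
  (embed-exL e p y∉ t (termOK-reach {t = t} _ d ok) c d s)
... | exR t ok | match (inR m) d (ex s) = on-right m λ c →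
  exR (substT _ t) (termOK-reach {t = substT _ t} _ d (embed-termOK {t = t} _ e ok)) (toProv (h (here refl))
    (embed-forms (match (inR (there (here refl))) d (same-inst t s (sym (substT-var _))) ∷ [])
      (embed-mono id id (cov-⊆ id insert₂ ∘ c) e)))
... | faL t q ok | match (inL m) d (fa s) = on-left m λ c →
  faL (substT _ t) (reach-trans d (embed-reach e q)) (embed-termOK {t = t} _ e ok) (toProv (h (here refl))
    (embed-forms (match (inL (there (here refl))) here (same-inst t s (sym (substT-var _))) ∷ [])
      (embed-mono id id (cov-⊆ insert₂ id ∘ c) e)))
... | faR u∉ y∉ | match (inR m) d (fa s) = on-right m λ c → faR (fresh-∉ _) (fresh-∉ _) (toProv (h (here refl))
  (embed-faR (embed-mono there there (cov-right there there id there
      (faR (var _) (reach-edge (here refl)) (termOK-var _ (here refl)) (inR (here refl))) ∘ c) e) p u∉ y∉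
    (reach-trans (reach-mono there d) (reach-edge (here refl)))
    (var _) (termOK-var _ (here refl)) (inR (here refl)) s))
... | faR u∉ y∉ | match (faR t q ok c) d (fa s) = toProv (h (here refl))
  (embed-faR e p u∉ y∉ (reach-trans d q) t ok c s)
... | ds refl | match {v} {pred _ ts} (inL m) d (pred eq) = on-left m λ c → ds refl (toProv (h (here refl))
  (embed-ds (embed-mono id (∈-++⁺ʳ (map (v ,_) (VTs ts)))
      (cov-bind id (∈-++⁺ʳ (map (v ,_) (VTs ts))) inL inR ∘ c) e)
    (∈-++⁺ˡ ∘ ∈-map⁺ (v ,_)) d eq))

theorem44 : (C : Calc) (R : List RelAtom) (T : List DomAtom) (Γ Δ : List LFormula)
    (w u : Label) (φ : Formula) →
    Reach R w u →
    IsSequent (mkSeq R T Γ ((w , φ) ∷ Δ)) →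
    IsSequent (mkSeq R T ((u , φ) ∷ Γ) Δ) →
    Prov C (mkSeq R T Γ ((w , φ) ∷ Δ)) →
    Prov C (mkSeq R T ((u , φ) ∷ Γ) Δ) →
    Prov C (mkSeq R T Γ Δ)
theorem44 C R T Γ Δ w u φ w↠u _ _ d₁ d₂ = toProv
  (cut-for φ (fromProv d₁) (fromProv d₂)
    (embed-tagged (all-tagged
      (tabulate λ p → match (inj₂ (∈-tagged-left p)) here same-refl)
      -- The right occurrence at `w` is matched with the cut formula at `u`, which absorbs the
      -- distance between the two labels.
      (match (inj₁ refl) w↠u same-refl ∷
       tabulate λ p → match (inj₂ (∈-tagged-right p)) here same-refl)))
    (embed-tagged (all-tagged
      (match (inj₁ refl) here same-refl ∷
       tabulate λ p → match (inj₂ (∈-tagged-left p)) here same-refl)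
      (tabulate λ p → match (inj₂ (∈-tagged-right p)) here same-refl))))
  -- Initially nothing has been decomposed: every formula is covered by its own presence.
  (embed-id id id (lookup (all-tagged {P = Cov C _} (tabulate inL) (tabulate inR))))
  where
  embed-tagged : ∀ {M Φ} → All (Match id var R M) Φ → Embed C id var (ctx R T Φ) R T M
  embed-tagged = embed (tabulate reach-edge) (tabulate (termOK-var C))
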